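{- Let $n\ge 4$ be an even integer. For every (possibly randomized) online algorithm $\mathrm{Alg}$ for non-bipartite online matching with general arrivals of $n$ requests in $[0,1]$, and for every real $c>0$, there exists a multiset $I$ of $n$ points of $[0,1]$ such that $$\mathbb E_{\pi,\mathrm{Alg}}\big[\mathrm{Alg}(\pi(I))\big]\ >\ c\cdot \mathrm{Opt}(I),$$ where $\pi(I)$ is a uniformly random permutation of $I$ and the expectation is over $\pi$ and the internal randomness of the algorithm. That is, the competitive ratio of any algorithm (even a randomized one) for online min-cost matching on the line with general arrivals in the random order model is unbounded for any $n\ge 4$.
   Context: The metric space is $[0,1]$ with $d(x,y)=|x-y|$. Non-bipartite online min-cost matching with general arrivals: $n$ requests ($n$ even, known to the algorithm) with locations in $[0,1]$ arrive one at a time in an order $r_1,\dots,r_n$. When $r_t$ arrives its location is revealed, and the algorithm must irrevocably either match $r_t$ to a previously arrived request that is still unmatched (any such request is allowed), or leave $r_t$ unmatched, to be matched with a future request. The decision may depend only on $n$, the requests $r_1,\dots,r_t$, the past decisions, and internal randomness; the algorithm does not know the instance in advance. After the arrival of $r_n$ all requests must be matched. The cost of a matching $M$ is $\sum_{\{r,r'\}\in M}|r-r'|$. $\mathrm{Alg}(\pi(I))$ is the cost of the perfect matching produced on arrival sequence $\pi(I)$, and $\mathrm{Opt}(I)$ is the minimum cost of a perfect matching of $I$. In the random order model the instance $I$ is worst-case and the arrival order is a uniformly random permutation; an algorithm is $c$-competitive if $\mathbb E_{\pi,\mathrm{Alg}}[\mathrm{Alg}(\pi(I))]\le c\cdot\mathrm{Opt}(I)$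 for all instances $I$ of $n$ requests. -}

module Defs where

open import Data.Bool.Base using (Bool; true; false; not)
open import Data.Fin.Base as Fin using (Fin; toℕ)
import Data.Fin.Properties as Finₚ
open import Data.Integer.Base using (+_)
open import Data.List.Base as List using (List; []; _∷_)
open import Data.Maybe.Base using (Maybe; just; nothing; maybe′)
import Data.Maybe.Properties as Maybeₚ
open import Data.Nat.Base as ℕ using (ℕ; zero; suc; _!)
open import Data.Nat.Properties as ℕₚ using (_!≢0)
open import Data.Product.Base using (∃-syntax; _×_; _,_)
open import Data.Rational.Base as ℚ using (ℚ; 0ℚ; 1ℚ; 1/_)
import Data.Rational.Properties as ℚₚ
open import Data.Rational.Solver using (module +-*-Solver)
open import Data.Sum.Base using (inj₁; inj₂)
open import Data.Vec.Base as Vec using (Vec; []; _∷_; lookup; tabulate; truncate)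
import Data.Vec.Properties as Vecₚ
open import Data.Vec.Relation.Binary.Pointwise.Inductive using (Pointwise)
open import Function.Bundles using (_⇔_)
open import Relation.Binary.Definitions using (DecidableEquality)
open import Relation.Binary.PropositionalEquality using (_≡_; refl; sym; cong; subst)
open import Relation.Nullary.Decidable using (does)

-- Two Cauchy sequences denote the same real number when they are related
-- by _≈_, not only when they are _≡_.

record ℝ : Set where
  constructor mkℝ
  field
    seq    : ℕ → ℚ
    cauchy : ∀ {ε} → 0ℚ ℚ.< ε →
             ∃[ N ] (∀ {i j} → N ℕ.≤ i → N ℕ.≤ j →
                     ℚ.∣ seq i ℚ.- seq j ∣ ℚ.< ε)

open ℝ public

infix 4 _≈_ _<_ _≤_

record _≈_ (x y : ℝ) : Set where
  constructor mk≈
  field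
    close : ∀ {ε} → 0ℚ ℚ.< ε →
            ∃[ N ] (∀ {i} → N ℕ.≤ i → ℚ.∣ seq x i ℚ.- seq y i ∣ ℚ.< ε)

record _<_ (x y : ℝ) : Set where
  constructor mk<
  field
    gap        : ℚ
    0<gap      : 0ℚ ℚ.< gap
    eventually : ∃[ N ] (∀ {i} → N ℕ.≤ i → seq x i ℚ.+ gap ℚ.≤ seq y i)

record _≤_ (x y : ℝ) : Set where
  constructor mk≤
  field
    eventually : ∀ {ε} → 0ℚ ℚ.< ε →
                 ∃[ N ] (∀ {i} → N ℕ.≤ i → seq x i ℚ.≤ seq y i ℚ.+ ε)

private
  half : ∀ {ε} → 0ℚ ℚ.< ε → 0ℚ ℚ.< ℚ.½ ℚ.* ε
  half {ε} 0<ε = subst (ℚ._< ℚ.½ ℚ.* ε) (ℚₚ.*-zeroʳ ℚ.½) (ℚₚ.*-monoʳ-<-pos ℚ.½ 0<ε)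

  halves : ∀ ε → ℚ.½ ℚ.* ε ℚ.+ ℚ.½ ℚ.* ε ≡ ε
  halves ε = begin
    ℚ.½ ℚ.* ε ℚ.+ ℚ.½ ℚ.* ε  ≡⟨ ℚₚ.*-distribʳ-+ ε ℚ.½ ℚ.½ ⟨
    1ℚ ℚ.* ε                 ≡⟨ ℚₚ.*-identityˡ ε ⟩
    ε                        ∎
    where open Relation.Binary.PropositionalEquality.≡-Reasoning

  divide : ∀ C {ε} → 0ℚ ℚ.< C → 0ℚ ℚ.< ε → ∃[ δ ] (0ℚ ℚ.< δ × C ℚ.* δ ≡ ε)
  divide C {ε} 0<C 0<ε = 1/ C ℚ.* ε , 0<δ , (begin
    C ℚ.* (1/ C ℚ.* ε)  ≡⟨ ℚₚ.*-assoc C (1/ C) ε ⟨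
    C ℚ.* 1/ C ℚ.* ε    ≡⟨ cong (ℚ._* ε) (ℚₚ.*-inverseʳ C) ⟩
    1ℚ ℚ.* ε            ≡⟨ ℚₚ.*-identityˡ ε ⟩
    ε                   ∎)
    where
    open Relation.Binary.PropositionalEquality.≡-Reasoning
    instance
      C-positive : ℚ.Positive C
      C-positive = ℚ.positive 0<C
      C-nonZero : ℚ.NonZero C
      C-nonZero = ℚₚ.pos⇒nonZero C
    0<δ : 0ℚ ℚ.< 1/ C ℚ.* ε
    0<δ = ℚₚ.positive⁻¹ _
      {{ℚₚ.pos*pos⇒pos (1/ C) {{ℚₚ.1/pos⇒pos C}} ε {{ℚ.positive 0<ε}}}}

  eventuallyBounded : ∀ x → ∃[ B ] (0ℚ ℚ.< B ×
                      ∃[ N ] (∀ {i} → N ℕ.≤ i → ℚ.∣ seq x i ∣ ℚ.≤ B))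
  eventuallyBounded x with N , close ← cauchy x (ℚₚ.positive⁻¹ 1ℚ) =
    b ℚ.+ 1ℚ , 0<B , N , bound
    where
    open ℚₚ.≤-Reasoning
    b : ℚ
    b = ℚ.∣ seq x N ∣
    0<B : 0ℚ ℚ.< b ℚ.+ 1ℚ
    0<B = ℚₚ.+-mono-≤-< (ℚₚ.0≤∣p∣ (seq x N)) (ℚₚ.positive⁻¹ 1ℚ)
    split : ∀ p q → p ≡ q ℚ.+ (p ℚ.- q)
    split = solve 2 (λ p q → p := q :+ (p :- q)) refl
      where open +-*-Solver
    bound : ∀ {i} → N ℕ.≤ i → ℚ.∣ seq x i ∣ ℚ.≤ b ℚ.+ 1ℚ
    bound {i} N≤i = begin
      ℚ.∣ seq x i ∣                            ≡⟨ cong ℚ.∣_∣ (split (seq x i) (seq x N)) ⟩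
      ℚ.∣ seq x N ℚ.+ (seq x i ℚ.- seq x N) ∣  ≤⟨ ℚₚ.∣p+q∣≤∣p∣+∣q∣ (seq x N) _ ⟩
      b ℚ.+ ℚ.∣ seq x i ℚ.- seq x N ∣          ≤⟨ ℚₚ.+-monoʳ-≤ b (ℚₚ.<⇒≤ (close N≤i ℕₚ.≤-refl)) ⟩
      b ℚ.+ 1ℚ                                 ∎

fromℚ : ℚ → ℝ
fromℚ q = mkℝ (λ _ → q) regular
  where
  abstract
    regular : ∀ {ε} → 0ℚ ℚ.< ε → ∃[ N ] (∀ {i j} → N ℕ.≤ i → N ℕ.≤ j →
              ℚ.∣ q ℚ.- q ∣ ℚ.< ε)
    regular {ε} 0<ε =
      0 , λ _ _ → subst (λ d → ℚ.∣ d ∣ ℚ.< ε) (sym (ℚₚ.+-inverseʳ q)) 0<ε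

0ℝ 1ℝ : ℝ
0ℝ = fromℚ 0ℚ
1ℝ = fromℚ 1ℚ

infixl 6 _+_ _-_
infixl 7 _*_

_+_ : ℝ → ℝ → ℝ
x + y = mkℝ (λ i → seq x i ℚ.+ seq y i) regular
  where
  rearrange : ∀ p q r s → (p ℚ.+ q) ℚ.- (r ℚ.+ s) ≡ (p ℚ.- r) ℚ.+ (q ℚ.- s)
  rearrange = solve 4 (λ p q r s → (p :+ q) :- (r :+ s) := (p :- r) :+ (q :- s)) refl
    where open +-*-Solver
  abstract
    regular : ∀ {ε} → 0ℚ ℚ.< ε → ∃[ N ] (∀ {i j} → N ℕ.≤ i → N ℕ.≤ j →
              ℚ.∣ (seq x i ℚ.+ seq y i) ℚ.- (seq x j ℚ.+ seq y j) ∣ ℚ.< ε)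
    regular {ε} 0<ε
      with M , x-close ← cauchy x (half 0<ε)
         | N , y-close ← cauchy y (half 0<ε) = M ℕ.⊔ N , λ {i} {j} ≤i ≤j → begin-strict
      ℚ.∣ (seq x i ℚ.+ seq y i) ℚ.- (seq x j ℚ.+ seq y j) ∣
        ≡⟨ cong ℚ.∣_∣ (rearrange (seq x i) (seq y i) (seq x j) (seq y j)) ⟩
      ℚ.∣ (seq x i ℚ.- seq x j) ℚ.+ (seq y i ℚ.- seq y j) ∣
        ≤⟨ ℚₚ.∣p+q∣≤∣p∣+∣q∣ (seq x i ℚ.- seq x j) (seq y i ℚ.- seq y j) ⟩
      ℚ.∣ seq x i ℚ.- seq x j ∣ ℚ.+ ℚ.∣ seq y i ℚ.- seq y j ∣
        <⟨ ℚₚ.+-mono-< (x-close (ℕₚ.m⊔n≤o⇒m≤o M N ≤i) (ℕₚ.m⊔n≤o⇒m≤o M N ≤j))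
                       (y-close (ℕₚ.m⊔n≤o⇒n≤o M N ≤i) (ℕₚ.m⊔n≤o⇒n≤o M N ≤j)) ⟩
      ℚ.½ ℚ.* ε ℚ.+ ℚ.½ ℚ.* ε
        ≡⟨ halves ε ⟩
      ε ∎
      where open ℚₚ.≤-Reasoning

-_ : ℝ → ℝ
- x = mkℝ (λ i → ℚ.- seq x i) regular
  where
  rearrange : ∀ p q → p ℚ.- q ≡ (ℚ.- q) ℚ.- (ℚ.- p)
  rearrange = solve 2 (λ p q → p :- q := (:- q) :- (:- p)) refl
    where open +-*-Solver
  abstract
    regular : ∀ {ε} → 0ℚ ℚ.< ε → ∃[ N ] (∀ {i j} → N ℕ.≤ i → N ℕ.≤ j →
              ℚ.∣ (ℚ.- seq x i) ℚ.- (ℚ.- seq x j) ∣ ℚ.< ε)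
    regular {ε} 0<ε = let N , close = cauchy x 0<ε in
      N , λ {i} {j} ≤i ≤j →
        subst (λ d → ℚ.∣ d ∣ ℚ.< ε) (rearrange (seq x j) (seq x i)) (close ≤j ≤i)

_-_ : ℝ → ℝ → ℝ
x - y = x + (- y)

∣_∣ : ℝ → ℝ
∣ x ∣ = mkℝ (λ i → ℚ.∣ seq x i ∣) regular
  where
  one-sided : ∀ p q → ℚ.∣ p ∣ ℚ.- ℚ.∣ q ∣ ℚ.≤ ℚ.∣ p ℚ.- q ∣
  one-sided p q = begin
    ℚ.∣ p ∣ ℚ.- ℚ.∣ q ∣                      ≡⟨ cong (λ r → ℚ.∣ r ∣ ℚ.- ℚ.∣ q ∣) (split p q) ⟩
    ℚ.∣ (p ℚ.- q) ℚ.+ q ∣ ℚ.- ℚ.∣ q ∣        ≤⟨ ℚₚ.+-monoˡ-≤ (ℚ.- ℚ.∣ q ∣) (ℚₚ.∣p+q∣≤∣p∣+∣q∣ (p ℚ.- q) q) ⟩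
    ℚ.∣ p ℚ.- q ∣ ℚ.+ ℚ.∣ q ∣ ℚ.- ℚ.∣ q ∣    ≡⟨ cancel ℚ.∣ p ℚ.- q ∣ ℚ.∣ q ∣ ⟩
    ℚ.∣ p ℚ.- q ∣                            ∎
    where
    open ℚₚ.≤-Reasoning
    open +-*-Solver using (solve; _:=_; _:+_; _:-_)
    split : ∀ p q → p ≡ (p ℚ.- q) ℚ.+ q
    split = solve 2 (λ p q → p := (p :- q) :+ q) refl
    cancel : ∀ p q → p ℚ.+ q ℚ.- q ≡ p
    cancel = solve 2 (λ p q → p :+ q :- q := p) refl
  swap : ∀ p q → ℚ.- (p ℚ.- q) ≡ q ℚ.- p
  swap = solve 2 (λ p q → :- (p :- q) := q :- p) refl
    where open +-*-Solver
  reverse-△ : ∀ p q → ℚ.∣ ℚ.∣ p ∣ ℚ.- ℚ.∣ q ∣ ∣ ℚ.≤ ℚ.∣ p ℚ.- q ∣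
  reverse-△ p q with ℚₚ.∣p∣≡p∨∣p∣≡-p (ℚ.∣ p ∣ ℚ.- ℚ.∣ q ∣)
  ... | inj₁ eq = subst (ℚ._≤ ℚ.∣ p ℚ.- q ∣) (sym eq) (one-sided p q)
  ... | inj₂ eq = begin
    ℚ.∣ ℚ.∣ p ∣ ℚ.- ℚ.∣ q ∣ ∣  ≡⟨ eq ⟩
    ℚ.- (ℚ.∣ p ∣ ℚ.- ℚ.∣ q ∣)  ≡⟨ swap ℚ.∣ p ∣ ℚ.∣ q ∣ ⟩
    ℚ.∣ q ∣ ℚ.- ℚ.∣ p ∣        ≤⟨ one-sided q p ⟩
    ℚ.∣ q ℚ.- p ∣              ≡⟨ cong ℚ.∣_∣ (swap p q) ⟨
    ℚ.∣ ℚ.- (p ℚ.- q) ∣        ≡⟨ ℚₚ.∣-p∣≡∣p∣ (p ℚ.- q) ⟩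
    ℚ.∣ p ℚ.- q ∣              ∎
    where open ℚₚ.≤-Reasoning
  abstract
    regular : ∀ {ε} → 0ℚ ℚ.< ε → ∃[ N ] (∀ {i j} → N ℕ.≤ i → N ℕ.≤ j →
              ℚ.∣ ℚ.∣ seq x i ∣ ℚ.- ℚ.∣ seq x j ∣ ∣ ℚ.< ε)
    regular 0<ε = let N , close = cauchy x 0<ε in
      N , λ {i} {j} ≤i ≤j → ℚₚ.≤-<-trans (reverse-△ (seq x i) (seq x j)) (close ≤i ≤j)

_*_ : ℝ → ℝ → ℝ
x * y = mkℝ (λ i → seq x i ℚ.* seq y i) regular
  where
  open ℚₚ.≤-Reasoning
  split : ∀ p q r s → p ℚ.* q ℚ.- r ℚ.* s ≡ p ℚ.* (q ℚ.- s) ℚ.+ s ℚ.* (p ℚ.- r)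
  split = solve 4 (λ p q r s → p :* q :- r :* s := p :* (q :- s) :+ s :* (p :- r)) refl
    where open +-*-Solver
  term : ∀ p q B δ → 0ℚ ℚ.< B → ℚ.∣ p ∣ ℚ.≤ B → ℚ.∣ q ∣ ℚ.< δ → ℚ.∣ p ℚ.* q ∣ ℚ.< B ℚ.* δ
  term p q B δ 0<B ∣p∣≤B ∣q∣<δ = begin-strict
    ℚ.∣ p ℚ.* q ∣        ≡⟨ ℚₚ.∣p*q∣≡∣p∣*∣q∣ p q ⟩
    ℚ.∣ p ∣ ℚ.* ℚ.∣ q ∣  ≤⟨ ℚₚ.*-monoʳ-≤-nonNeg ℚ.∣ q ∣ {{ℚₚ.∣-∣-nonNeg q}} ∣p∣≤B ⟩
    B ℚ.* ℚ.∣ q ∣        <⟨ ℚₚ.*-monoʳ-<-pos B {{ℚ.positive 0<B}} ∣q∣<δ ⟩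
    B ℚ.* δ              ∎
  combine : ∀ p q r s A B δ → 0ℚ ℚ.< A → 0ℚ ℚ.< B → ℚ.∣ p ∣ ℚ.≤ A → ℚ.∣ s ∣ ℚ.≤ B →
            ℚ.∣ p ℚ.- r ∣ ℚ.< δ → ℚ.∣ q ℚ.- s ∣ ℚ.< δ →
            ℚ.∣ p ℚ.* q ℚ.- r ℚ.* s ∣ ℚ.< (A ℚ.+ B) ℚ.* δ
  combine p q r s A B δ 0<A 0<B ∣p∣≤A ∣s∣≤B p-r q-s = begin-strict
    ℚ.∣ p ℚ.* q ℚ.- r ℚ.* s ∣            ≡⟨ cong ℚ.∣_∣ (split p q r s) ⟩
    ℚ.∣ u ℚ.+ v ∣                        ≤⟨ ℚₚ.∣p+q∣≤∣p∣+∣q∣ u v ⟩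
    ℚ.∣ u ∣ ℚ.+ ℚ.∣ v ∣                  <⟨ ℚₚ.+-mono-< {ℚ.∣ u ∣} {A ℚ.* δ} {ℚ.∣ v ∣} {B ℚ.* δ}
                                              (term p (q ℚ.- s) A δ 0<A ∣p∣≤A q-s)
                                              (term s (p ℚ.- r) B δ 0<B ∣s∣≤B p-r) ⟩
    A ℚ.* δ ℚ.+ B ℚ.* δ                  ≡⟨ ℚₚ.*-distribʳ-+ δ A B ⟨
    (A ℚ.+ B) ℚ.* δ                      ∎
    where
    u v : ℚ
    u = p ℚ.* (q ℚ.- s)
    v = s ℚ.* (p ℚ.- r)
  abstract
    regular : ∀ {ε} → 0ℚ ℚ.< ε → ∃[ N ] (∀ {i j} → N ℕ.≤ i → N ℕ.≤ j →
              ℚ.∣ seq x i ℚ.* seq y i ℚ.- seq x j ℚ.* seq y j ∣ ℚ.< ε)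
    regular {ε} 0<ε =
      let A , 0<A , K , x-bound = eventuallyBounded x
          B , 0<B , L , y-bound = eventuallyBounded y
          δ , 0<δ , [A+B]δ≡ε    = divide (A ℚ.+ B) (ℚₚ.+-mono-< 0<A 0<B) 0<ε
          M , x-close           = cauchy x 0<δ
          N , y-close           = cauchy y 0<δ
      in K ℕ.⊔ L ℕ.⊔ (M ℕ.⊔ N) , λ {i} {j} ≤i ≤j →
      let KL≤i = ℕₚ.m⊔n≤o⇒m≤o (K ℕ.⊔ L) (M ℕ.⊔ N) ≤i
          KL≤j = ℕₚ.m⊔n≤o⇒m≤o (K ℕ.⊔ L) (M ℕ.⊔ N) ≤j
          MN≤i = ℕₚ.m⊔n≤o⇒n≤o (K ℕ.⊔ L) (M ℕ.⊔ N) ≤i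
          MN≤j = ℕₚ.m⊔n≤o⇒n≤o (K ℕ.⊔ L) (M ℕ.⊔ N) ≤j
      in subst (ℚ.∣ seq x i ℚ.* seq y i ℚ.- seq x j ℚ.* seq y j ∣ ℚ.<_) [A+B]δ≡ε
        (combine (seq x i) (seq y i) (seq x j) (seq y j) A B δ 0<A 0<B
          (x-bound (ℕₚ.m⊔n≤o⇒m≤o K L KL≤i))
          (y-bound (ℕₚ.m⊔n≤o⇒n≤o K L KL≤j))
          (x-close (ℕₚ.m⊔n≤o⇒m≤o M N MN≤i) (ℕₚ.m⊔n≤o⇒m≤o M N MN≤j))
          (y-close (ℕₚ.m⊔n≤o⇒n≤o M N MN≤i) (ℕₚ.m⊔n≤o⇒n≤o M N MN≤j)))

∑ : List ℝ → ℝ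
∑ = List.foldr _+_ 0ℝ

partialSum : (ℕ → ℝ) → ℕ → ℝ
partialSum a zero    = 0ℝ
partialSum a (suc k) = partialSum a k + a k

infix 4 _⟶_

record _⟶_ (a : ℕ → ℝ) (l : ℝ) : Set where
  constructor mk⟶
  field
    eventually : ∀ {ε} → 0ℝ < ε → ∃[ N ] (∀ {k} → N ℕ.≤ k → ∣ a k - l ∣ < ε)

-- Events are represented by Bool-valued indicator functions.  Since the
-- union of a sequence of events need not be computable, closure under
-- countable unions and countable additivity speak about any event U that
-- is the union.

IsUnion : {Ω : Set} → (ℕ → Ω → Bool) → (Ω → Bool) → Set
IsUnion A U = ∀ ω → U ω ≡ true ⇔ (∃[ i ] A i ω ≡ true)

Disjoint : {Ω : Set} → (ℕ → Ω → Bool) → Set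
Disjoint A = ∀ {i j} ω → A i ω ≡ true → A j ω ≡ true → i ≡ j

-- The values of ℙ at non-measurable arguments are unconstrained.

record ProbabilitySpace : Set₁ where
  field
    Ω          : Set
    Measurable : (Ω → Bool) → Set
    ℙ          : (Ω → Bool) → ℝ

    measurable-∅ : Measurable (λ _ → false)
    measurable-∁ : ∀ {A} → Measurable A → Measurable (λ ω → not (A ω))
    measurable-⋃ : ∀ {A U} → (∀ i → Measurable (A i)) → IsUnion A U → Measurable U

    ℙ-nonneg   : ∀ {A} → Measurable A → 0ℝ ≤ ℙ A
    ℙ-∅        : ℙ (λ _ → false) ≈ 0ℝ
    ℙ-total    : ℙ (λ _ → true) ≈ 1ℝ
    ℙ-additive : ∀ {A U} → (∀ i → Measurable (A i)) → Disjoint A → IsUnion A U →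
                 partialSum (λ i → ℙ (A i)) ⟶ ℙ U

record Point : Set where
  constructor point
  field
    loc   : ℝ
    0≤loc : 0ℝ ≤ loc
    loc≤1 : loc ≤ 1ℝ

open Point public

dist : Point → Point → ℝ
dist p q = ∣ loc p - loc q ∣

_≈ₚ_ : Point → Point → Set
p ≈ₚ q = loc p ≈ loc q

-- A matching of the requests 0, …, n - 1 records each pair at its later
-- member: entry t is  just s  if t is matched to the earlier request s, and
-- nothing  if t is unmatched or matched to a later request.

Matching : ℕ → Set
Matching n = Vec (Maybe (Fin n)) n

record IsPerfect {n} (M : Matching n) : Set where
  field
    earlier : ∀ {s t} → lookup M t ≡ just s → s Fin.< t
    free    : ∀ {s t} → lookup M t ≡ just s → lookup M s ≡ nothing
    unique  : ∀ {s t t′} → lookup M t ≡ just s → lookup M t′ ≡ just s → t ≡ t′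
    covered : ∀ {s} → lookup M s ≡ nothing → ∃[ t ] lookup M t ≡ just s

cost : ∀ {n} → Vec Point n → Matching n → ℝ
cost {n} r M =
  ∑ (List.map (λ t → maybe′ (λ s → dist (lookup r s) (lookup r t)) 0ℝ (lookup M t))
              (List.allFin n))

record IsOpt {n} (I : Vec Point n) (o : ℝ) : Set where
  field
    attained : ∃[ M ] (IsPerfect M × cost I M ≈ o)
    minimal  : ∀ {M} → IsPerfect M → o ≤ cost I M

_≟ᴹ_ : ∀ {n} → DecidableEquality (Matching n)
_≟ᴹ_ = Vecₚ.≡-dec (Maybeₚ.≡-dec Finₚ._≟_)

vectors : {A : Set} → List A → ∀ k → List (Vec A k)
vectors as zero    = [] ∷ []
vectors as (suc k) = List.cartesianProductWith _∷_ as (vectors as k)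

allMatchings : ∀ n → List (Matching n)
allMatchings n = vectors (nothing ∷ List.map just (List.allFin n)) n

-- The internal randomness is a seed ω, drawn once and available in every
-- step.  Given ω, the past decisions are determined by the past requests, so
-- they are not a separate argument of decide.  The vector passed to decide
-- in step t holds the requests 0, …, t.

record OnlineAlgorithm (n : ℕ) : Set₁ where
  field
    space : ProbabilitySpace

  open ProbabilitySpace space public

  field
    decide : Ω → (t : Fin n) → Vec Point (suc (toℕ t)) → Maybe (Fin n)

    decide-cong : ∀ ω t {r r′} → Pointwise _≈ₚ_ r r′ → decide ω t r ≡ decide ω t r′

    decide-measurable : ∀ t r d →
      Measurable (λ ω → does (Maybeₚ.≡-dec Finₚ._≟_ (decide ω t r) d))

  run : Ω → Vec Point n → Matching n
  run ω r = tabulate (λ t → decide ω t (truncate (Finₚ.toℕ<n t) r))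

  field
    run-perfect : ∀ ω r → IsPerfect (run ω r)

  expectedCost : Vec Point n → ℝ
  expectedCost r =
    ∑ (List.map (λ M → ℙ (λ ω → does (run ω r ≟ᴹ M)) * cost r M) (allMatchings n))

insertions : {A : Set} → A → ∀ {k} → Vec A k → List (Vec A (suc k))
insertions x []       = (x ∷ []) ∷ []
insertions x (y ∷ ys) = (x ∷ y ∷ ys) ∷ List.map (y ∷_) (insertions x ys)

-- All n ! rearrangements, with repetitions when entries coincide.

permutations : {A : Set} → ∀ {n} → Vec A n → List (Vec A n)
permutations []       = [] ∷ []
permutations (x ∷ xs) = List.concatMap (insertions x) (permutations xs)

randomOrderCost : ∀ {n} → OnlineAlgorithm n → Vec Point n → ℝ
randomOrderCost {n} Alg I =
  fromℚ (ℚ._/_ (+ 1) (n !) {{n !≢0}}) * ∑ (List.map expectedCost (permutations I))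
  where open OnlineAlgorithm Alg

{-# OPTIONS --safe #-}
module Submission where

-- Let the requests at 1 come first, in even number n − 4, followed by one at 0
-- and one at δ.  If either of the last two is matched on arrival, the
-- continuation 0, δ makes that choice cost at least δ, whereas the optimum is 0.
-- If both are left unmatched, the continuation 1, 1 forces them to be matched
-- to requests at 1, at cost at least 1, whereas the optimum is δ.  The algorithm
-- cannot tell the two instances apart in time, so either the first
-- event has positive probability or the second has probability at least ½; since
-- each arrival order has weight at least 1/n!, it suffices that c δ < 1/(2 n!).

open import Defs
open import Data.Bool.Base using (Bool; true; false; not; _∧_; _∨_)
open import Data.Bool.Properties using (∧-zeroʳ; ∨-zeroʳ)
open import Data.Fin.Base as Fin using (Fin; zero; suc; toℕ)
import Data.Fin.Properties as Finₚ
open import Data.Integer.Base using (+_)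
open import Data.List.Base as List using (List; []; _∷_)
import Data.List.Properties as Listₚ
open import Data.List.Membership.Propositional using (_∈_)
open import Data.List.Membership.Propositional.Properties
  using (∈-allFin; ∈-cartesianProductWith⁺; ∈-concatMap⁺; ∈-map⁺)
open import Data.List.Relation.Unary.Any as Any using (here; there)
open import Data.Maybe.Base as Maybe using (Maybe; just; nothing; maybe′)
import Data.Maybe.Properties as Maybeₚ
open import Data.Nat.Base as ℕ using (ℕ; zero; suc; _!)
open import Data.Nat.Properties as ℕₚ using (_!≢0)
open import Data.Nat.Divisibility using (_∣_; divides)
open import Data.Product.Base using (Σ-syntax; ∃-syntax; _×_; _,_; proj₁; proj₂)
open import Data.Rational.Base as ℚ using (ℚ; 0ℚ; 1ℚ; ½; 1/_)
import Data.Rational.Properties as ℚₚ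
open import Data.Rational.Solver using (module +-*-Solver)
open import Data.Sum.Base as Sum using (_⊎_; inj₁; inj₂)
open import Data.Vec.Base as Vec using (Vec; []; _∷_; lookup; tabulate; truncate)
import Data.Vec.Properties as Vecₚ
open import Function.Bundles using (mk⇔)
open import Relation.Binary.Definitions using (DecidableEquality)
open import Relation.Binary.PropositionalEquality
  using (_≡_; _≢_; refl; sym; trans; cong; cong₂; subst; subst₂)
open import Relation.Nullary.Decidable using (Dec; yes; no; does)
open import Relation.Nullary.Negation using (contradiction)

-- Rational and real inequalities

open +-*-Solver using (solve; _:=_; _:+_; _:-_; _:*_; :-_; con)

-ℚ-nonneg : ∀ {p q} → p ℚ.≤ q → 0ℚ ℚ.≤ q ℚ.- p
-ℚ-nonneg {p} {q} p≤q =
  subst (ℚ._≤ q ℚ.- p) (ℚₚ.+-inverseʳ p) (ℚₚ.+-monoˡ-≤ (ℚ.- p) p≤q)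

*ℚ-nonneg : ∀ {p q} → 0ℚ ℚ.≤ p → 0ℚ ℚ.≤ q → 0ℚ ℚ.≤ p ℚ.* q
*ℚ-nonneg {p} {q} 0≤p 0≤q = subst (ℚ._≤ p ℚ.* q) (ℚₚ.*-zeroʳ p)
  (ℚₚ.*-monoˡ-≤-nonNeg p {{ℚ.nonNegative 0≤p}} 0≤q)

*ℚ-pos : ∀ {p q} → 0ℚ ℚ.< p → 0ℚ ℚ.< q → 0ℚ ℚ.< p ℚ.* q
*ℚ-pos {p} {q} 0<p 0<q = subst (ℚ._< p ℚ.* q) (ℚₚ.*-zeroʳ p)
  (ℚₚ.*-monoʳ-<-pos p {{ℚ.positive 0<p}} 0<q)

0<½ : 0ℚ ℚ.< ½
0<½ = ℚₚ.positive⁻¹ ½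

p≤p+nonneg : ∀ {p q} → 0ℚ ℚ.≤ q → p ℚ.≤ p ℚ.+ q
p≤p+nonneg {p} {q} 0≤q = subst (ℚ._≤ p ℚ.+ q) (ℚₚ.+-identityʳ p) (ℚₚ.+-monoʳ-≤ p 0≤q)

p≤∣p∣ : ∀ p → p ℚ.≤ ℚ.∣ p ∣
p≤∣p∣ p with ℚₚ.≤-total 0ℚ p
... | inj₁ 0≤p = ℚₚ.≤-reflexive (sym (ℚₚ.0≤p⇒∣p∣≡p 0≤p))
... | inj₂ p≤0 = ℚₚ.≤-trans p≤0 (ℚₚ.0≤∣p∣ p)

∣p-q∣≡∣q-p∣ : ∀ p q → ℚ.∣ p ℚ.- q ∣ ≡ ℚ.∣ q ℚ.- p ∣
∣p-q∣≡∣q-p∣ p q = trans (sym (ℚₚ.∣-p∣≡∣p∣ (p ℚ.- q))) (cong ℚ.∣_∣ (swap p q))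
  where
  swap : ∀ p q → ℚ.- (p ℚ.- q) ≡ q ℚ.- p
  swap = solve 2 (λ p q → :- (p :- q) := q :- p) refl

q-∣p-q∣≤p : ∀ p q → q ℚ.- ℚ.∣ p ℚ.- q ∣ ℚ.≤ p
q-∣p-q∣≤p p q = begin
  q ℚ.- ℚ.∣ p ℚ.- q ∣  ≡⟨ cong (λ r → q ℚ.- r) (∣p-q∣≡∣q-p∣ p q) ⟩
  q ℚ.- ℚ.∣ q ℚ.- p ∣  ≤⟨ ℚₚ.+-monoʳ-≤ q (ℚₚ.neg-antimono-≤ (p≤∣p∣ (q ℚ.- p))) ⟩
  q ℚ.- (q ℚ.- p)      ≡⟨ solve 2 (λ p q → q :- (q :- p) := p) refl p q ⟩
  p                    ∎
  where open ℚₚ.≤-Reasoning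

p≤q+∣p-q∣ : ∀ p q → p ℚ.≤ q ℚ.+ ℚ.∣ p ℚ.- q ∣
p≤q+∣p-q∣ p q = begin
  p                    ≡⟨ solve 2 (λ p q → p := q :+ (p :- q)) refl p q ⟩
  q ℚ.+ (p ℚ.- q)      ≤⟨ ℚₚ.+-monoʳ-≤ q (p≤∣p∣ (p ℚ.- q)) ⟩
  q ℚ.+ ℚ.∣ p ℚ.- q ∣  ∎
  where open ℚₚ.≤-Reasoning

-- If `q < p`, density gives a rational `r` strictly between them, and the slack `r - q` yields
-- `p ≤ r < p`.
≤-via-ε : ∀ {p q} → (∀ {ε} → 0ℚ ℚ.< ε → p ℚ.≤ q ℚ.+ ε) → p ℚ.≤ q
≤-via-ε {p} {q} p≤q+ = ℚₚ.≮⇒≥ λ q<p →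
  let r , q<r , r<p = ℚₚ.<-dense q<p
      0<r-q = subst (ℚ._< r ℚ.- q) (ℚₚ.+-inverseʳ q) (ℚₚ.+-monoˡ-< (ℚ.- q) q<r)
      p≤r = subst (p ℚ.≤_) (solve 2 (λ q r → q :+ (r :- q) := r) refl q r) (p≤q+ 0<r-q)
  in ℚₚ.<-irrefl refl (ℚₚ.<-≤-trans r<p p≤r)

smallMultiple : ∀ {K ε b} → 0ℚ ℚ.< K → 0ℚ ℚ.< ε → 0ℚ ℚ.< b →
                ∃[ δ ] (0ℚ ℚ.< δ × δ ℚ.≤ b × K ℚ.* δ ℚ.≤ ε)
smallMultiple {K} {ε} {b} 0<K 0<ε 0<b =
  b ℚ.⊓ d , 0<δ , ℚₚ.p⊓q≤p b d , (begin
    K ℚ.* (b ℚ.⊓ d)      ≤⟨ ℚₚ.*-monoˡ-≤-nonNeg K {{ℚₚ.pos⇒nonNeg K}} (ℚₚ.p⊓q≤q b d) ⟩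
    K ℚ.* (1/ K ℚ.* ε)   ≡⟨ ℚₚ.*-assoc K (1/ K) ε ⟨
    K ℚ.* 1/ K ℚ.* ε     ≡⟨ cong (ℚ._* ε) (ℚₚ.*-inverseʳ K) ⟩
    1ℚ ℚ.* ε             ≡⟨ ℚₚ.*-identityˡ ε ⟩
    ε                    ∎)
  where
  open ℚₚ.≤-Reasoning
  instance
    K-positive : ℚ.Positive K
    K-positive = ℚ.positive 0<K
    K-nonZero : ℚ.NonZero K
    K-nonZero = ℚₚ.pos⇒nonZero K
  d : ℚ
  d = 1/ K ℚ.* ε
  0<d : 0ℚ ℚ.< d
  0<d = *ℚ-pos (ℚₚ.positive⁻¹ (1/ K) {{ℚₚ.1/pos⇒pos K}}) 0<ε
  0<δ : 0ℚ ℚ.< b ℚ.⊓ d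
  0<δ with ℚₚ.⊓-sel b d
  ... | inj₁ eq = subst (0ℚ ℚ.<_) (sym eq) 0<b
  ... | inj₂ eq = subst (0ℚ ℚ.<_) (sym eq) 0<d

pointwise⇒≤ : ∀ {x y} → (∀ i → seq x i ℚ.≤ seq y i) → x ≤ y
pointwise⇒≤ x≤y = mk≤ λ 0<ε → 0 , λ {i} _ → ℚₚ.≤-trans (x≤y i) (p≤p+nonneg (ℚₚ.<⇒≤ 0<ε))

≗⇒≤ : ∀ {x y} → (∀ i → seq x i ≡ seq y i) → x ≤ y
≗⇒≤ x≗y = pointwise⇒≤ λ i → ℚₚ.≤-reflexive (x≗y i)

≗⇒≈ : ∀ {x y} → (∀ i → seq x i ≡ seq y i) → x ≈ y
≗⇒≈ {x} {y} x≗y = mk≈ λ {ε} 0<ε → 0 , λ {i} _ → subst (ℚ._< ε)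
  (sym (cong ℚ.∣_∣ (trans (cong (λ r → r ℚ.- seq y i) (x≗y i)) (ℚₚ.+-inverseʳ (seq y i))))) 0<ε

≤-refl : ∀ {x} → x ≤ x
≤-refl = ≗⇒≤ λ _ → refl

≤-trans : ∀ {x y z} → x ≤ y → y ≤ z → x ≤ z
≤-trans {x} {y} {z} (mk≤ x≤y) (mk≤ y≤z) = mk≤ λ {ε} 0<ε →
  let M , x≤y+ = x≤y (*ℚ-pos 0<½ 0<ε)
      N , y≤z+ = y≤z (*ℚ-pos 0<½ 0<ε)
  in M ℕ.⊔ N , λ {i} ≤i → begin
    seq x i                                  ≤⟨ x≤y+ (ℕₚ.m⊔n≤o⇒m≤o M N ≤i) ⟩
    seq y i ℚ.+ ½ ℚ.* ε                      ≤⟨ ℚₚ.+-monoˡ-≤ (½ ℚ.* ε) (y≤z+ (ℕₚ.m⊔n≤o⇒n≤o M N ≤i)) ⟩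
    seq z i ℚ.+ ½ ℚ.* ε ℚ.+ ½ ℚ.* ε          ≡⟨ solve 2 (λ z e → z :+ con ½ :* e :+ con ½ :* e := z :+ e) refl (seq z i) ε ⟩
    seq z i ℚ.+ ε                            ∎
  where open ℚₚ.≤-Reasoning

+-mono-≤ : ∀ {x y u v} → x ≤ y → u ≤ v → x + u ≤ y + v
+-mono-≤ {x} {y} {u} {v} (mk≤ x≤y) (mk≤ u≤v) = mk≤ λ {ε} 0<ε →
  let M , x≤y+ = x≤y (*ℚ-pos 0<½ 0<ε)
      N , u≤v+ = u≤v (*ℚ-pos 0<½ 0<ε)
  in M ℕ.⊔ N , λ {i} ≤i → begin
    seq x i ℚ.+ seq u i                              ≤⟨ ℚₚ.+-mono-≤ (x≤y+ (ℕₚ.m⊔n≤o⇒m≤o M N ≤i)) (u≤v+ (ℕₚ.m⊔n≤o⇒n≤o M N ≤i)) ⟩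
    (seq y i ℚ.+ ½ ℚ.* ε) ℚ.+ (seq v i ℚ.+ ½ ℚ.* ε)  ≡⟨ solve 3 (λ y v e → (y :+ con ½ :* e) :+ (v :+ con ½ :* e) := (y :+ v) :+ e) refl (seq y i) (seq v i) ε ⟩
    (seq y i ℚ.+ seq v i) ℚ.+ ε                      ∎
  where open ℚₚ.≤-Reasoning

≈⇒≤ : ∀ {x y} → x ≈ y → x ≤ y
≈⇒≤ {x} {y} (mk≈ close) = mk≤ λ 0<ε → let N , x~y = close 0<ε in
  N , λ {i} ≤i → ℚₚ.≤-trans (p≤q+∣p-q∣ (seq x i) (seq y i)) (ℚₚ.+-monoʳ-≤ (seq y i) (ℚₚ.<⇒≤ (x~y ≤i)))

≈⇒≥ : ∀ {x y} → x ≈ y → y ≤ x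
≈⇒≥ {x} {y} (mk≈ close) = ≈⇒≤ (mk≈ λ {ε} 0<ε → let N , x~y = close 0<ε in
  N , λ {i} ≤i → subst (ℚ._< ε) (∣p-q∣≡∣q-p∣ (seq x i) (seq y i)) (x~y ≤i))

open import Relation.Binary.Reasoning.Base.Single _≤_ ≤-refl ≤-trans using (begin_; step-∼; _∎)

fromℚ-mono-≤ : ∀ {p q} → p ℚ.≤ q → fromℚ p ≤ fromℚ q
fromℚ-mono-≤ p≤q = pointwise⇒≤ λ _ → p≤q

fromℚ-cancel-≤ : ∀ {p q} → fromℚ p ≤ fromℚ q → p ℚ.≤ q
fromℚ-cancel-≤ (mk≤ p≤q) = ≤-via-ε λ 0<ε → let N , p≤q+ = p≤q 0<ε in p≤q+ {N} ℕₚ.≤-refl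

x≤x+nonneg : ∀ {x y} → 0ℝ ≤ y → x ≤ x + y
x≤x+nonneg {x} {y} 0≤y = begin
  x       ∼⟨ ≗⇒≤ (λ i → sym (ℚₚ.+-identityʳ (seq x i))) ⟩
  x + 0ℝ  ∼⟨ +-mono-≤ ≤-refl 0≤y ⟩
  x + y   ∎

y≤nonneg+y : ∀ {x y} → 0ℝ ≤ x → y ≤ x + y
y≤nonneg+y {x} {y} 0≤x = begin
  y       ∼⟨ ≗⇒≤ (λ i → sym (ℚₚ.+-identityˡ (seq y i))) ⟩
  0ℝ + y  ∼⟨ +-mono-≤ 0≤x ≤-refl ⟩
  x + y   ∎

boundedAbove : ∀ x → ∃[ B ] (0ℚ ℚ.< B × ∃[ N ] (∀ {i} → N ℕ.≤ i → seq x i ℚ.≤ B))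
boundedAbove x with N , close ← cauchy x (ℚₚ.positive⁻¹ 1ℚ) =
  ℚ.∣ seq x N ∣ ℚ.+ 1ℚ
  , ℚₚ.+-mono-≤-< (ℚₚ.0≤∣p∣ (seq x N)) (ℚₚ.positive⁻¹ 1ℚ)
  , N , λ {i} N≤i → ℚₚ.≤-trans (p≤q+∣p-q∣ (seq x i) (seq x N))
          (ℚₚ.+-mono-≤ (p≤∣p∣ (seq x N)) (ℚₚ.<⇒≤ (close N≤i ℕₚ.≤-refl)))

-- The terms of a nonnegative real may be slightly negative, so both factors are first raised by
-- `δ`. Undoing the shift costs at most a constant multiple of `δ`, where the constant comes from
-- eventual upper bounds on `x` and `y`.
*-nonneg : ∀ {x y} → 0ℝ ≤ x → 0ℝ ≤ y → 0ℝ ≤ x * y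
*-nonneg {x} {y} (mk≤ 0≤x) (mk≤ 0≤y) = mk≤ λ {ε} 0<ε →
  let X , 0<X , K , x≤X = boundedAbove x
      Y , 0<Y , L , y≤Y = boundedAbove y
      δ , 0<δ , δ≤1 , Cδ≤ε = smallMultiple {X ℚ.+ Y ℚ.+ 1ℚ} {ε} {1ℚ}
        (ℚₚ.+-mono-< (ℚₚ.+-mono-< 0<X 0<Y) (ℚₚ.positive⁻¹ 1ℚ)) 0<ε (ℚₚ.positive⁻¹ 1ℚ)
      M , 0≤x+δ = 0≤x 0<δ
      N , 0≤y+δ = 0≤y 0<δ
  in K ℕ.⊔ L ℕ.⊔ (M ℕ.⊔ N) , λ {i} ≤i →
     let KL≤i = ℕₚ.m⊔n≤o⇒m≤o (K ℕ.⊔ L) (M ℕ.⊔ N) ≤i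
         MN≤i = ℕₚ.m⊔n≤o⇒n≤o (K ℕ.⊔ L) (M ℕ.⊔ N) ≤i
     in ℚₚ.≤-trans
       (estimate (seq x i) (seq y i) X Y δ (ℚₚ.<⇒≤ 0<δ) δ≤1
          (x≤X (ℕₚ.m⊔n≤o⇒m≤o K L KL≤i)) (y≤Y (ℕₚ.m⊔n≤o⇒n≤o K L KL≤i))
          (0≤x+δ (ℕₚ.m⊔n≤o⇒m≤o M N MN≤i)) (0≤y+δ (ℕₚ.m⊔n≤o⇒n≤o M N MN≤i)))
       (ℚₚ.+-monoʳ-≤ (seq x i ℚ.* seq y i) Cδ≤ε)
  where
  estimate : ∀ p q X Y δ → 0ℚ ℚ.≤ δ → δ ℚ.≤ 1ℚ → p ℚ.≤ X → q ℚ.≤ Y →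
             0ℚ ℚ.≤ p ℚ.+ δ → 0ℚ ℚ.≤ q ℚ.+ δ →
             0ℚ ℚ.≤ p ℚ.* q ℚ.+ (X ℚ.+ Y ℚ.+ 1ℚ) ℚ.* δ
  -- The right-hand side is `(p + δ)(q + δ)` plus `δ` times the three slacks `X - p`, `Y - q` and
  -- `1 - δ`, all of them nonnegative.
  estimate p q X Y δ 0≤δ δ≤1 p≤X q≤Y 0≤p+δ 0≤q+δ = subst (0ℚ ℚ.≤_)
    (solve 5 (λ p q X Y δ →
        (p :+ δ) :* (q :+ δ) :+ ((X :- p) :+ (Y :- q) :+ (con 1ℚ :- δ)) :* δ
        := p :* q :+ (X :+ Y :+ con 1ℚ) :* δ) refl p q X Y δ)
    (ℚₚ.+-mono-≤ (*ℚ-nonneg 0≤p+δ 0≤q+δ)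
      (*ℚ-nonneg (ℚₚ.+-mono-≤ (ℚₚ.+-mono-≤ (-ℚ-nonneg p≤X) (-ℚ-nonneg q≤Y)) (-ℚ-nonneg δ≤1)) 0≤δ))

*-monoʳ-≤ : ∀ {x y z} → 0ℝ ≤ x → y ≤ z → x * y ≤ x * z
*-monoʳ-≤ {x} {y} {z} 0≤x y≤z = begin
  x * y                    ∼⟨ x≤x+nonneg (*-nonneg 0≤x 0≤z-y) ⟩
  x * y + x * (z - y)      ∼⟨ ≗⇒≤ (λ i → solve 3 (λ x y z → x :* y :+ x :* (z :- y) := x :* z) refl (seq x i) (seq y i) (seq z i)) ⟩
  x * z                    ∎
  where
  0≤z-y : 0ℝ ≤ z - y
  0≤z-y = begin
    0ℝ     ∼⟨ ≗⇒≤ (λ i → sym (ℚₚ.+-inverseʳ (seq y i))) ⟩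
    y - y  ∼⟨ +-mono-≤ y≤z (≤-refl { - y}) ⟩
    z - y  ∎

<-≤-trans : ∀ {x y z} → x < y → y ≤ z → x < z
<-≤-trans {x} {y} {z} (mk< gap 0<gap (M , x+gap≤y)) (mk≤ y≤z) =
  let N , y≤z+ = y≤z (*ℚ-pos 0<½ 0<gap)
  in mk< (½ ℚ.* gap) (*ℚ-pos 0<½ 0<gap) (M ℕ.⊔ N , λ {i} ≤i →
    subst₂ ℚ._≤_
      (solve 2 (λ x g → (x :+ g) :- con ½ :* g := x :+ con ½ :* g) refl (seq x i) gap)
      (solve 2 (λ z g → (z :+ con ½ :* g) :- con ½ :* g := z) refl (seq z i) gap)
      (ℚₚ.+-monoˡ-≤ (ℚ.- (½ ℚ.* gap)) (ℚₚ.≤-trans (x+gap≤y (ℕₚ.m⊔n≤o⇒m≤o M N ≤i))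
                                                (y≤z+ (ℕₚ.m⊔n≤o⇒n≤o M N ≤i)))))

≤-<-trans : ∀ {x y z} → x ≤ y → y < z → x < z
≤-<-trans {x} {y} {z} (mk≤ x≤y) (mk< gap 0<gap (M , y+gap≤z)) =
  let N , x≤y+ = x≤y (*ℚ-pos 0<½ 0<gap)
  in mk< (½ ℚ.* gap) (*ℚ-pos 0<½ 0<gap) (M ℕ.⊔ N , λ {i} ≤i → ℚₚ.≤-trans
    (subst (seq x i ℚ.+ ½ ℚ.* gap ℚ.≤_)
      (solve 2 (λ y g → (y :+ con ½ :* g) :+ con ½ :* g := y :+ g) refl (seq y i) gap)
      (ℚₚ.+-monoˡ-≤ (½ ℚ.* gap) (x≤y+ (ℕₚ.m⊔n≤o⇒n≤o M N ≤i))))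
    (y+gap≤z (ℕₚ.m⊔n≤o⇒m≤o M N ≤i)))

scale-pos : ∀ {k x} → 0ℚ ℚ.< k → 0ℝ < x → 0ℝ < fromℚ k * x
scale-pos {k} {x} 0<k (mk< gap 0<gap (N , gap≤x)) =
  mk< (k ℚ.* gap) (*ℚ-pos 0<k 0<gap) (N , λ {i} N≤i →
    subst (ℚ._≤ k ℚ.* seq x i) (sym (ℚₚ.+-identityˡ (k ℚ.* gap)))
      (ℚₚ.*-monoˡ-≤-nonNeg k {{ℚₚ.pos⇒nonNeg k {{ℚ.positive 0<k}}}}
        (subst (ℚ._≤ seq x i) (ℚₚ.+-identityˡ gap) (gap≤x N≤i))))

-- A constructive replacement for deciding whether `x` is positive: the two alternatives overlap, so
-- an approximation suffices. A term that is within `η/4` of all later ones is compared with `η/2`;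
-- either outcome leaves a margin of `η/4`.
positive-or-≤ : ∀ x {η} → 0ℚ ℚ.< η → 0ℝ < x ⊎ x ≤ fromℚ η
positive-or-≤ x {η} 0<η = decide (cauchy x 0<η/4)
  where
  open ℚₚ.≤-Reasoning renaming (begin_ to beginℚ_; _∎ to _∎ℚ)
  η/4 : ℚ
  η/4 = ½ ℚ.* (½ ℚ.* η)
  0<η/4 : 0ℚ ℚ.< η/4
  0<η/4 = *ℚ-pos 0<½ (*ℚ-pos 0<½ 0<η)
  decide : ∃[ N ] (∀ {i j} → N ℕ.≤ i → N ℕ.≤ j → ℚ.∣ seq x i ℚ.- seq x j ∣ ℚ.< η/4) →
           0ℝ < x ⊎ x ≤ fromℚ η
  decide (N , close) with seq x N ℚₚ.≤? ½ ℚ.* η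
  ... | yes small = inj₂ (mk≤ λ {ε} 0<ε → N , λ {i} N≤i → beginℚ
      seq x i                                  ≤⟨ p≤q+∣p-q∣ (seq x i) (seq x N) ⟩
      seq x N ℚ.+ ℚ.∣ seq x i ℚ.- seq x N ∣    ≤⟨ ℚₚ.+-mono-≤ small (ℚₚ.<⇒≤ (close N≤i ℕₚ.≤-refl)) ⟩
      ½ ℚ.* η ℚ.+ η/4                          ≤⟨ p≤p+nonneg (ℚₚ.+-mono-≤ (ℚₚ.<⇒≤ 0<η/4) (ℚₚ.<⇒≤ 0<ε)) ⟩
      ½ ℚ.* η ℚ.+ η/4 ℚ.+ (η/4 ℚ.+ ε)          ≡⟨ solve 2 (λ η ε → con ½ :* η :+ con ½ :* (con ½ :* η) :+ (con ½ :* (con ½ :* η) :+ ε) := η :+ ε) refl η ε ⟩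
      η ℚ.+ ε                                  ∎ℚ)
  ... | no large = inj₁ (mk< η/4 0<η/4 (N , λ {i} N≤i → beginℚ
      0ℚ ℚ.+ η/4                               ≡⟨ solve 1 (λ η → con 0ℚ :+ con ½ :* (con ½ :* η) := con ½ :* η :- con ½ :* (con ½ :* η)) refl η ⟩
      ½ ℚ.* η ℚ.- η/4                          ≤⟨ ℚₚ.+-mono-≤ (ℚₚ.<⇒≤ (ℚₚ.≰⇒> large)) (ℚₚ.neg-antimono-≤ (ℚₚ.<⇒≤ (close N≤i ℕₚ.≤-refl))) ⟩
      seq x N ℚ.- ℚ.∣ seq x i ℚ.- seq x N ∣    ≤⟨ q-∣p-q∣≤p (seq x i) (seq x N) ⟩
      seq x i                                  ∎ℚ))

-- With an eventual rational upper bound `B` of `c`, it suffices that `B δ ≤ ε/2`; the other half of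
-- `ε` is the gap required by the strict inequality.
scaleBelow : ∀ c {ε b} → 0ℚ ℚ.< ε → 0ℚ ℚ.< b →
             ∃[ δ ] (0ℚ ℚ.< δ × δ ℚ.≤ b × c * fromℚ δ < fromℚ ε)
scaleBelow c {ε} {b} 0<ε 0<b =
  let B , 0<B , N , c≤B = boundedAbove c
      δ , 0<δ , δ≤b , Bδ≤ε/2 = smallMultiple {B} {½ ℚ.* ε} {b} 0<B (*ℚ-pos 0<½ 0<ε) 0<b
  in δ , 0<δ , δ≤b , mk< (½ ℚ.* ε) (*ℚ-pos 0<½ 0<ε) (N , λ {i} N≤i → beginℚ
    seq c i ℚ.* δ ℚ.+ ½ ℚ.* ε  ≤⟨ ℚₚ.+-monoˡ-≤ (½ ℚ.* ε) (ℚₚ.≤-trans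
                                    (ℚₚ.*-monoʳ-≤-nonNeg δ {{ℚₚ.pos⇒nonNeg δ {{ℚ.positive 0<δ}}}} (c≤B N≤i)) Bδ≤ε/2) ⟩
    ½ ℚ.* ε ℚ.+ ½ ℚ.* ε        ≡⟨ solve 1 (λ e → con ½ :* e :+ con ½ :* e := e) refl ε ⟩
    ε                          ∎ℚ)
  where open ℚₚ.≤-Reasoning renaming (begin_ to beginℚ_; _∎ to _∎ℚ)

-- Finite sums and limits of reals

∑-nonneg : {A : Set} {f : A → ℝ} → (∀ a → 0ℝ ≤ f a) → ∀ as → 0ℝ ≤ ∑ (List.map f as)
∑-nonneg 0≤f []       = ≤-refl
∑-nonneg 0≤f (a ∷ as) = ≤-trans (0≤f a) (x≤x+nonneg (∑-nonneg 0≤f as))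

term≤∑ : {A : Set} {f : A → ℝ} → (∀ a → 0ℝ ≤ f a) → ∀ {a as} → a ∈ as → f a ≤ ∑ (List.map f as)
term≤∑ 0≤f {as = _ ∷ as} (here refl) = x≤x+nonneg (∑-nonneg 0≤f as)
term≤∑ 0≤f {as = a ∷ _}  (there a∈)  = ≤-trans (term≤∑ 0≤f a∈) (y≤nonneg+y (0≤f a))

-- A single member `a (m + K)` is enough: it is both past the point of convergence and of the form
-- that the bound covers. Half of `ε` pays for its distance to the limit, half for the comparison of
-- reals.
⟶-≥ : ∀ {a l x} m → (∀ k → x ≤ a (m ℕ.+ k)) → a ⟶ l → x ≤ l
⟶-≥ {a} {l} {x} m x≤a (mk⟶ lim) = mk≤ λ {ε} 0<ε →
  let 0<ε/2 = *ℚ-pos 0<½ 0<ε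
      K , close = lim {fromℚ (½ ℚ.* ε)} (mk< (½ ℚ.* ε) 0<ε/2 (0 , λ _ → ℚₚ.≤-reflexive (ℚₚ.+-identityˡ (½ ℚ.* ε))))
      mk< gap 0<gap (N , near) = close {m ℕ.+ K} (ℕₚ.m≤n+m K m)
      M , x≤a+ = _≤_.eventually (x≤a K) 0<ε/2
      ak = seq (a (m ℕ.+ K))
  in M ℕ.⊔ N , λ {i} ≤i → beginℚ
    seq x i                                              ≤⟨ x≤a+ (ℕₚ.m⊔n≤o⇒m≤o M N ≤i) ⟩
    ak i ℚ.+ ½ ℚ.* ε                                     ≤⟨ ℚₚ.+-monoˡ-≤ (½ ℚ.* ε) (p≤q+∣p-q∣ (ak i) (seq l i)) ⟩
    seq l i ℚ.+ ℚ.∣ ak i ℚ.- seq l i ∣ ℚ.+ ½ ℚ.* ε       ≤⟨ ℚₚ.+-monoˡ-≤ (½ ℚ.* ε) (ℚₚ.+-monoʳ-≤ (seq l i)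
                                                              (ℚₚ.≤-trans (p≤p+nonneg (ℚₚ.<⇒≤ 0<gap)) (near (ℕₚ.m⊔n≤o⇒n≤o M N ≤i)))) ⟩
    seq l i ℚ.+ ½ ℚ.* ε ℚ.+ ½ ℚ.* ε                      ≡⟨ solve 2 (λ z e → z :+ con ½ :* e :+ con ½ :* e := z :+ e) refl (seq l i) ε ⟩
    seq l i ℚ.+ ε                                        ∎ℚ
  where open ℚₚ.≤-Reasoning renaming (begin_ to beginℚ_; _∎ to _∎ℚ)

⟶-≤ : ∀ {a l x} m → (∀ k → a (m ℕ.+ k) ≤ x) → a ⟶ l → l ≤ x
⟶-≤ {a} {l} {x} m a≤x (mk⟶ lim) = mk≤ λ {ε} 0<ε →
  let 0<ε/2 = *ℚ-pos 0<½ 0<ε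
      K , close = lim {fromℚ (½ ℚ.* ε)} (mk< (½ ℚ.* ε) 0<ε/2 (0 , λ _ → ℚₚ.≤-reflexive (ℚₚ.+-identityˡ (½ ℚ.* ε))))
      mk< gap 0<gap (N , near) = close {m ℕ.+ K} (ℕₚ.m≤n+m K m)
      M , a≤x+ = _≤_.eventually (a≤x K) 0<ε/2
      ak = seq (a (m ℕ.+ K))
  in M ℕ.⊔ N , λ {i} ≤i → beginℚ
    seq l i                                              ≤⟨ p≤q+∣p-q∣ (seq l i) (ak i) ⟩
    ak i ℚ.+ ℚ.∣ seq l i ℚ.- ak i ∣                      ≡⟨ cong (ak i ℚ.+_) (∣p-q∣≡∣q-p∣ (seq l i) (ak i)) ⟩
    ak i ℚ.+ ℚ.∣ ak i ℚ.- seq l i ∣                      ≤⟨ ℚₚ.+-mono-≤ (a≤x+ (ℕₚ.m⊔n≤o⇒m≤o M N ≤i))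
                                                              (ℚₚ.≤-trans (p≤p+nonneg (ℚₚ.<⇒≤ 0<gap)) (near (ℕₚ.m⊔n≤o⇒n≤o M N ≤i))) ⟩
    seq x i ℚ.+ ½ ℚ.* ε ℚ.+ ½ ℚ.* ε                      ≡⟨ solve 2 (λ z e → z :+ con ½ :* e :+ con ½ :* e := z :+ e) refl (seq x i) ε ⟩
    seq x i ℚ.+ ε                                        ∎ℚ
  where open ℚₚ.≤-Reasoning renaming (begin_ to beginℚ_; _∎ to _∎ℚ)

-- Probability

∧-true : ∀ {a b} → a ∧ b ≡ true → a ≡ true × b ≡ true
∧-true {true} {true} _ = refl , refl

module Probability (S : ProbabilitySpace) where
  open ProbabilitySpace S

  -- Closure and additivity of a probability space speak of sequences, so two events are continued
  -- by empty ones.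
  pair : (Ω → Bool) → (Ω → Bool) → ℕ → Ω → Bool
  pair A B 0             = A
  pair A B 1             = B
  pair A B (suc (suc _)) = λ _ → false

  pair-measurable : ∀ {A B} → Measurable A → Measurable B → ∀ i → Measurable (pair A B i)
  pair-measurable mA mB 0             = mA
  pair-measurable mA mB 1             = mB
  pair-measurable mA mB (suc (suc _)) = measurable-∅

  pair-union : ∀ {A B U} → (∀ ω → A ω ≡ true → U ω ≡ true) → (∀ ω → B ω ≡ true → U ω ≡ true) →
               (∀ ω → U ω ≡ true → A ω ≡ true ⊎ B ω ≡ true) → IsUnion (pair A B) U
  pair-union {A} {B} A⊆U B⊆U U⊆A∪B ω = mk⇔ (λ u → Sum.[ (0 ,_) , (1 ,_) ]′ (U⊆A∪B ω u)) from
    where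
    from : ∃[ i ] pair A B i ω ≡ true → _
    from (0 , a) = A⊆U ω a
    from (1 , b) = B⊆U ω b

  -- Pointwise equal indicators need not be `_≡_`, but `B` is a union of the constant sequence `A`,
  -- and closure applies to any event that is the union.
  measurable-resp : ∀ {A B} → (∀ ω → A ω ≡ B ω) → Measurable A → Measurable B
  measurable-resp A≗B mA = measurable-⋃ (λ _ → mA) λ ω →
    mk⇔ (λ b → 0 , trans (A≗B ω) b) (λ (_ , a) → trans (sym (A≗B ω)) a)

  measurable-∪ : ∀ {A B} → Measurable A → Measurable B → Measurable (λ ω → A ω ∨ B ω)
  measurable-∪ {A} {B} mA mB = measurable-⋃ (pair-measurable mA mB) (pair-union
    (λ ω a → cong (_∨ B ω) a)
    (λ ω b → trans (cong (A ω ∨_) b) (∨-zeroʳ (A ω)))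
    (λ ω → split (A ω) (B ω)))
    where
    split : ∀ a b → a ∨ b ≡ true → a ≡ true ⊎ b ≡ true
    split true  b _ = inj₁ refl
    split false b p = inj₂ p

  measurable-∩ : ∀ {A B} → Measurable A → Measurable B → Measurable (λ ω → A ω ∧ B ω)
  measurable-∩ {A} {B} mA mB = measurable-resp (λ ω → deMorgan (A ω) (B ω))
    (measurable-∁ (measurable-∪ (measurable-∁ mA) (measurable-∁ mB)))
    where
    deMorgan : ∀ a b → not (not a ∨ not b) ≡ a ∧ b
    deMorgan true  true  = refl
    deMorgan true  false = refl
    deMorgan false _     = refl

  -- From index 2 on, every partial sum is `ℙ A + ℙ B` up to terms `ℙ ∅ ≈ 0`, so the limit `ℙ U` is
  -- bounded on both sides by this value.
  ℙ-additive₂ : ∀ {A B U} → Measurable A → Measurable B →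
    (∀ ω → A ω ≡ true → B ω ≡ false) →
    (∀ ω → A ω ≡ true → U ω ≡ true) → (∀ ω → B ω ≡ true → U ω ≡ true) →
    (∀ ω → U ω ≡ true → A ω ≡ true ⊎ B ω ≡ true) →
    (ℙ A + ℙ B ≤ ℙ U) × (ℙ U ≤ ℙ A + ℙ B)
  ℙ-additive₂ {A} {B} {U} mA mB A#B A⊆U B⊆U U⊆A∪B =
    ⟶-≥ 2 (λ k → proj₁ (partial k)) limit , ⟶-≤ 2 (λ k → proj₂ (partial k)) limit
    where
    absurd : ∀ {b} {X : Set} → b ≡ false → b ≡ true → X
    absurd refl ()

    disjoint : Disjoint (pair A B)
    disjoint {0} {0} ω _ _ = refl
    disjoint {0} {1} ω a b = absurd (A#B ω a) b
    disjoint {1} {0} ω b a = absurd (A#B ω a) b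
    disjoint {1} {1} ω _ _ = refl

    limit : partialSum (λ i → ℙ (pair A B i)) ⟶ ℙ U
    limit = ℙ-additive (pair-measurable mA mB) disjoint (pair-union A⊆U B⊆U U⊆A∪B)

    partial : ∀ k → let s = partialSum (λ i → ℙ (pair A B i)) (2 ℕ.+ k) in
              (ℙ A + ℙ B ≤ s) × (s ≤ ℙ A + ℙ B)
    partial zero =
        ≗⇒≤ (λ i → cong (ℚ._+ seq (ℙ B) i) (sym (ℚₚ.+-identityˡ (seq (ℙ A) i))))
      , ≗⇒≤ (λ i → cong (ℚ._+ seq (ℙ B) i) (ℚₚ.+-identityˡ (seq (ℙ A) i)))
    partial (suc k) with lower , upper ← partial k =
        ≤-trans lower (x≤x+nonneg (≈⇒≥ ℙ-∅))
      , ≤-trans (+-mono-≤ upper (≈⇒≤ ℙ-∅))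
                (≗⇒≤ λ i → ℚₚ.+-identityʳ _)

  ℙ-split : ∀ {C} D → Measurable C → Measurable D →
            ℙ C ≤ ℙ (λ ω → C ω ∧ D ω) + ℙ (λ ω → C ω ∧ not (D ω))
  ℙ-split {C} D mC mD = proj₂ (ℙ-additive₂ (measurable-∩ mC mD) (measurable-∩ mC (measurable-∁ mD))
    (λ ω → disjoint (C ω) (D ω))
    (λ ω c∧d → proj₁ (∧-true c∧d)) (λ ω c∧d → proj₁ (∧-true c∧d))
    (λ ω → cover (C ω) (D ω)))
    where
    disjoint : ∀ c d → c ∧ d ≡ true → c ∧ not d ≡ false
    disjoint true true _ = refl
    cover : ∀ c d → c ≡ true → c ∧ d ≡ true ⊎ c ∧ not d ≡ true
    cover true true  _ = inj₁ refl
    cover true false _ = inj₂ refl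

  -- `B` is the disjoint union of `A` and the rest of `B`, whose probability is nonnegative.
  ℙ-mono : ∀ {A B} → Measurable A → Measurable B → (∀ ω → A ω ≡ true → B ω ≡ true) → ℙ A ≤ ℙ B
  ℙ-mono {A} {B} mA mB A⊆B = ≤-trans (x≤x+nonneg (ℙ-nonneg mB∖A))
    (proj₁ (ℙ-additive₂ mA mB∖A
      (λ ω a → trans (cong (λ b → B ω ∧ not b) a) (∧-zeroʳ (B ω)))
      A⊆B (λ ω b → proj₁ (∧-true b)) (λ ω → cover (A ω) (B ω))))
    where
    mB∖A : Measurable (λ ω → B ω ∧ not (A ω))
    mB∖A = measurable-∩ mB (measurable-∁ mA)
    cover : ∀ a b → b ≡ true → a ≡ true ⊎ b ∧ not a ≡ true
    cover true  b    _ = inj₁ refl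
    cover false true _ = inj₂ refl

  -- The decision procedure on vectors computes to a conjunction over the entries, so the event is a
  -- finite intersection. This lifts measurability from single decisions to whole runs.
  measurable-tabulate : {D : Set} (_≟_ : DecidableEquality D) → ∀ {k} (f : Ω → Fin k → D) →
    (∀ t d → Measurable (λ ω → does (f ω t ≟ d))) →
    ∀ v → Measurable (λ ω → does (Vecₚ.≡-dec _≟_ (tabulate (f ω)) v))
  measurable-tabulate _≟_ {zero}  f mf []      =
    measurable-resp (λ _ → refl) (measurable-∁ measurable-∅)
  measurable-tabulate _≟_ {suc k} f mf (d ∷ v) =
    measurable-∩ (mf zero d) (measurable-tabulate _≟_ (λ ω t → f ω (suc t)) (λ t → mf (suc t)) v)

-- Expected cost

∈-vectors : {A : Set} {as : List A} → (∀ a → a ∈ as) → ∀ {k} (v : Vec A k) → v ∈ vectors as k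
∈-vectors ∈as []      = here refl
∈-vectors ∈as (a ∷ v) = ∈-cartesianProductWith⁺ _∷_ (∈as a) (∈-vectors ∈as v)

∈-allMatchings : ∀ {n} (M : Matching n) → M ∈ allMatchings n
∈-allMatchings {n} = ∈-vectors λ where
  nothing  → here refl
  (just s) → there (∈-map⁺ just (∈-allFin s))

pairCost-nonneg : ∀ {n} (r : Vec Point n) t (m : Maybe (Fin n)) →
  0ℝ ≤ maybe′ (λ s → dist (lookup r s) (lookup r t)) 0ℝ m
pairCost-nonneg r t nothing  = ≤-refl
pairCost-nonneg r t (just s) = pointwise⇒≤ λ i → ℚₚ.0≤∣p∣ _

cost-nonneg : ∀ {n} (r : Vec Point n) M → 0ℝ ≤ cost r M
cost-nonneg {n} r M = ∑-nonneg (λ t → pairCost-nonneg r t (lookup M t)) (List.allFin n)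

dist≤cost : ∀ {n} (r : Vec Point n) M {s t} → lookup M t ≡ just s →
            dist (lookup r s) (lookup r t) ≤ cost r M
dist≤cost {n} r M {s} {t} eq = subst (λ m → maybe′ (λ s → dist (lookup r s) (lookup r t)) 0ℝ m ≤ cost r M) eq
  (term≤∑ (λ t → pairCost-nonneg r t (lookup M t)) (∈-allFin t))

module Expectation {n} (Alg : OnlineAlgorithm n) where
  open OnlineAlgorithm Alg
  open Probability space public

  outcome : Vec Point n → Matching n → Ω → Bool
  outcome r M ω = does (run ω r ≟ᴹ M)

  outcome-measurable : ∀ r M → Measurable (outcome r M)
  outcome-measurable r = measurable-tabulate (Maybeₚ.≡-dec Finₚ._≟_) _
    (λ t → decide-measurable t (truncate (Finₚ.toℕ<n t) r))

  term-nonneg : ∀ r M → 0ℝ ≤ ℙ (outcome r M) * cost r M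
  term-nonneg r M = *-nonneg (ℙ-nonneg (outcome-measurable r M)) (cost-nonneg r M)

  expectedCost-nonneg : ∀ r → 0ℝ ≤ expectedCost r
  expectedCost-nonneg r = ∑-nonneg (term-nonneg r) (allMatchings n)

  -- Real comparisons are undecidable, so the matchings of cost at least κ can be
  -- singled out only because κ ≤ cost is assumed decidable.
  markov : ∀ r {κ} → 0ℚ ℚ.≤ κ → (∀ M → Dec (fromℚ κ ≤ cost r M)) →
    ∀ {C} → Measurable C → (∀ ω → C ω ≡ true → fromℚ κ ≤ cost r (run ω r)) →
    fromℚ κ * ℙ C ≤ expectedCost r
  markov r {κ} 0≤κ κ≤cost? mC κ≤cost =
    go (allMatchings n) mC λ ω c → ∈-allMatchings (run ω r) , κ≤cost ω c
    where
    κ≥0 : 0ℝ ≤ fromℚ κ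
    κ≥0 = fromℚ-mono-≤ 0≤κ
    -- Induction over the candidate matchings: the event shrinks along with the list, so that on `C`
    -- the run is always among those still to be treated.
    go : ∀ Ms {C} → Measurable C →
         (∀ ω → C ω ≡ true → run ω r ∈ Ms × fromℚ κ ≤ cost r (run ω r)) →
         fromℚ κ * ℙ C ≤ ∑ (List.map (λ M → ℙ (outcome r M) * cost r M) Ms)
    go [] {C} mC ev = begin
      fromℚ κ * ℙ C                ∼⟨ *-monoʳ-≤ κ≥0 (ℙ-mono mC measurable-∅ (λ ω c → impossible (proj₁ (ev ω c)))) ⟩
      fromℚ κ * ℙ (λ _ → false)    ∼⟨ *-monoʳ-≤ κ≥0 (≈⇒≤ ℙ-∅) ⟩
      fromℚ κ * 0ℝ                 ∼⟨ ≗⇒≤ (λ _ → ℚₚ.*-zeroʳ κ) ⟩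
      0ℝ                           ∎
      where
      impossible : ∀ {M b} → M ∈ [] → b ≡ true
      impossible ()
    go (M ∷ Ms) {C} mC ev = begin
      fromℚ κ * ℙ C                              ∼⟨ *-monoʳ-≤ κ≥0 (ℙ-split X mC mX) ⟩
      fromℚ κ * (ℙ C∩X + ℙ C∖X)                  ∼⟨ ≗⇒≤ (λ i → ℚₚ.*-distribˡ-+ κ (seq (ℙ C∩X) i) (seq (ℙ C∖X) i)) ⟩
      fromℚ κ * ℙ C∩X + fromℚ κ * ℙ C∖X          ∼⟨ +-mono-≤ (head (κ≤cost? M)) (go Ms mC∖X rest) ⟩
      ∑ (List.map (λ M → ℙ (outcome r M) * cost r M) (M ∷ Ms))  ∎
      where
      X C∩X C∖X : Ω → Bool
      X     = outcome r M
      C∩X ω = C ω ∧ X ω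
      C∖X ω = C ω ∧ not (X ω)
      mX : Measurable X
      mX = outcome-measurable r M
      mC∩X : Measurable C∩X
      mC∩X = measurable-∩ mC mX
      mC∖X : Measurable C∖X
      mC∖X = measurable-∩ mC (measurable-∁ mX)
      X⇒run≡M : ∀ ω → X ω ≡ true → run ω r ≡ M
      X⇒run≡M ω x with run ω r ≟ᴹ M
      ... | yes eq = eq
      head : Dec (fromℚ κ ≤ cost r M) → fromℚ κ * ℙ C∩X ≤ ℙ X * cost r M
      head (yes κ≤costM) = begin
        fromℚ κ * ℙ C∩X   ∼⟨ *-monoʳ-≤ κ≥0 (ℙ-mono mC∩X mX (λ ω cx → proj₂ (∧-true cx))) ⟩
        fromℚ κ * ℙ X     ∼⟨ ≗⇒≤ (λ i → ℚₚ.*-comm κ (seq (ℙ X) i)) ⟩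
        ℙ X * fromℚ κ     ∼⟨ *-monoʳ-≤ (ℙ-nonneg mX) κ≤costM ⟩
        ℙ X * cost r M    ∎
      -- A matching cheaper than `κ` cannot be the run on `C`, so `C∩X` is contained in the empty
      -- event.
      head (no κ≰costM) = begin
        fromℚ κ * ℙ C∩X              ∼⟨ *-monoʳ-≤ κ≥0 (ℙ-mono mC∩X measurable-∅ λ ω cx →
                                          contradiction (subst (λ M → fromℚ κ ≤ cost r M)
                                            (X⇒run≡M ω (proj₂ (∧-true cx)))
                                            (proj₂ (ev ω (proj₁ (∧-true cx))))) κ≰costM) ⟩
        fromℚ κ * ℙ (λ _ → false)    ∼⟨ *-monoʳ-≤ κ≥0 (≈⇒≤ ℙ-∅) ⟩
        fromℚ κ * 0ℝ                 ∼⟨ ≗⇒≤ (λ _ → ℚₚ.*-zeroʳ κ) ⟩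
        0ℝ                           ∼⟨ term-nonneg r M ⟩
        ℙ X * cost r M               ∎
      rest : ∀ ω → C∖X ω ≡ true → run ω r ∈ Ms × fromℚ κ ≤ cost r (run ω r)
      rest ω c∖x with c , ¬x ← ∧-true {C ω} c∖x with ev ω c
      ... | there ∈Ms , κ≤ = ∈Ms , κ≤
      ... | here eq   , κ≤ with run ω r ≟ᴹ M
      ...   | no ¬eq = contradiction eq ¬eq

  -- One arrival order already has weight `1 / n !`, and the other orders contribute nonnegative
  -- amounts.
  randomOrderCost-≥ : ∀ I {r} → r ∈ permutations I → ∀ {x} → x ≤ expectedCost r →
    fromℚ (ℚ._/_ (+ 1) (n !) {{n !≢0}}) * x ≤ randomOrderCost Alg I
  randomOrderCost-≥ I r∈ x≤ = *-monoʳ-≤ (fromℚ-mono-≤ 0≤ρ)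
    (≤-trans x≤ (term≤∑ expectedCost-nonneg r∈))
    where
    0≤ρ : 0ℚ ℚ.≤ ℚ._/_ (+ 1) (n !) {{n !≢0}}
    0≤ρ = ℚₚ.nonNegative⁻¹ _ {{ℚₚ.normalize-nonNeg 1 (n !) {{n !≢0}}}}

-- Padded request sequences

-- The length is written so that it reduces to two successors for each unit of `k`; each pair of
-- copies then fits one application of `addPair`.
pad : {A : Set} → A → ∀ {m} → Vec A m → ∀ k → Vec A (k ℕ.* 2 ℕ.+ m)
pad x v zero    = v
pad x v (suc k) = x ∷ x ∷ pad x v k

late : ∀ k {m} → Fin m → Fin (k ℕ.* 2 ℕ.+ m)
late zero    t = t
late (suc k) t = suc (suc (late k t))

late-cancel-< : ∀ k {m} {s t : Fin m} → late k s Fin.< late k t → s Fin.< t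
late-cancel-< zero    s<t = s<t
late-cancel-< (suc k) s<t = late-cancel-< k (ℕ.s<s⁻¹ (ℕ.s<s⁻¹ s<t))

late-cancel-≤ : ∀ k {m} {s t : Fin m} → late k s Fin.≤ late k t → s Fin.≤ t
late-cancel-≤ zero    s≤t = s≤t
late-cancel-≤ (suc k) s≤t = late-cancel-≤ k (ℕ.s≤s⁻¹ (ℕ.s≤s⁻¹ s≤t))

lookup-late : {A : Set} (x : A) → ∀ {m} (v : Vec A m) k t → lookup (pad x v k) (late k t) ≡ lookup v t
lookup-late x v zero    t = refl
lookup-late x v (suc k) t = lookup-late x v k t

-- A view of the indices of a padded vector. The padding case records just what the cost arguments
-- use: the index precedes the whole tail, and its entry does not depend on the tail.
data Position (k : ℕ) {m : ℕ} : Fin (k ℕ.* 2 ℕ.+ m) → Set₁ where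
  padding : ∀ {s} → (∀ (t : Fin m) → s Fin.< late k t) →
            (∀ {A : Set} (x : A) (v : Vec A m) → lookup (pad x v k) s ≡ x) → Position k s
  tail    : ∀ (t : Fin m) → Position k (late k t)

position : ∀ k {m} (s : Fin (k ℕ.* 2 ℕ.+ m)) → Position k s
position zero    s             = tail s
position (suc k) zero          = padding (λ _ → ℕ.s≤s ℕ.z≤n) (λ _ _ → refl)
position (suc k) (suc zero)    = padding (λ _ → ℕ.s≤s (ℕ.s≤s ℕ.z≤n)) (λ _ _ → refl)
position (suc k) (suc (suc s)) with position k s
... | padding s< ≡x = padding (λ t → ℕ.s≤s (ℕ.s≤s (s< t))) ≡x
... | tail t        = tail t

-- This is how the online restriction enters: the decision in step `t` receives only this
-- truncation, so sequences that agree up to `t` cannot be told apart.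
truncate-cong : {A : Set} → ∀ {n} (t : Fin n) (t<n : toℕ t ℕ.< n) {r r′ : Vec A n} →
  (∀ s → s Fin.≤ t → lookup r s ≡ lookup r′ s) → truncate t<n r ≡ truncate t<n r′
truncate-cong zero    (ℕ.s≤s _)   {x ∷ _} {y ∷ _} agree = cong (_∷ []) (agree zero ℕ.z≤n)
truncate-cong (suc t) (ℕ.s≤s t<n) {x ∷ _} {y ∷ _} agree =
  cong₂ _∷_ (agree zero ℕ.z≤n) (truncate-cong t t<n λ s s≤t → agree (suc s) (ℕ.s≤s s≤t))

∷-∈-permutations : {A : Set} (x : A) → ∀ {n} (u v : Vec A n) →
                   u ∈ permutations v → (x ∷ u) ∈ permutations (x ∷ v)
∷-∈-permutations x u v u∈ = ∈-concatMap⁺ (insertions x) (Any.map (λ { refl → front u }) u∈)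
  where
  front : ∀ {n} (u : Vec _ n) → (x ∷ u) ∈ insertions x u
  front []      = here refl
  front (_ ∷ _) = here refl

-- The padding stays in place, each copy being reinserted at the front, and only the tail is
-- rearranged.
pad-∈-permutations : {A B : Set} (f : A → B) (x : A) → ∀ {m} (u v : Vec A m) →
  Vec.map f u ∈ permutations (Vec.map f v) →
  ∀ k → Vec.map f (pad x u k) ∈ permutations (Vec.map f (pad x v k))
pad-∈-permutations f x u v u∈ zero    = u∈
pad-∈-permutations f x u v u∈ (suc k) =
  ∷-∈-permutations (f x) (f x ∷ u′) (f x ∷ v′)
    (∷-∈-permutations (f x) u′ v′ (pad-∈-permutations f x u v u∈ k))
  where
  u′ = Vec.map f (pad x u k)
  v′ = Vec.map f (pad x v k)

∈-permutations-refl : {A : Set} → ∀ {n} (v : Vec A n) → v ∈ permutations v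
∈-permutations-refl []      = here refl
∈-permutations-refl (x ∷ v) = ∷-∈-permutations x v v (∈-permutations-refl v)

-- Matchings extended by a pair of leading requests

addPair : ∀ {n} → Matching n → Matching (suc (suc n))
addPair M = nothing ∷ just zero ∷ Vec.map (Maybe.map (λ s → suc (suc s))) M

addPair-lift : ∀ {n} (M : Matching n) {m t} → lookup M t ≡ m →
               lookup (addPair M) (suc (suc t)) ≡ Maybe.map (λ s → suc (suc s)) m
addPair-lift M {t = t} refl = Vecₚ.lookup-map t (Maybe.map (λ s → suc (suc s))) M

-- In particular no old request is matched into the new pair, which is what rules out the mixed
-- cases of `addPair-perfect`.
addPair-just : ∀ {n} (M : Matching n) {s t} → lookup (addPair M) (suc (suc t)) ≡ just s →
               ∃[ s′ ] (s ≡ suc (suc s′) × lookup M t ≡ just s′)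
addPair-just M {t = t} eq with lookup M t | trans (sym (addPair-lift M {t = t} refl)) eq
... | just s′ | refl = s′ , refl , refl

addPair-perfect : ∀ {n} {M : Matching n} → IsPerfect M → IsPerfect (addPair M)
addPair-perfect {M = M} perfect = record
  { earlier = λ {s} {t} → earlier′ {s} {t}
  ; free    = λ {s} {t} → free′ {s} {t}
  ; unique  = λ {s} {t} {t′} → unique′ {s} {t} {t′}
  ; covered = covered′ }
  where
  open IsPerfect perfect
  earlier′ : ∀ {s t} → lookup (addPair M) t ≡ just s → s Fin.< t
  earlier′ {t = suc zero}    refl = ℕ.s≤s ℕ.z≤n
  earlier′ {t = suc (suc t)} eq with _ , refl , eq′ ← addPair-just M {t = t} eq =
    ℕ.s≤s (ℕ.s≤s (earlier eq′))
  free′ : ∀ {s t} → lookup (addPair M) t ≡ just s → lookup (addPair M) s ≡ nothing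
  free′ {t = suc zero}    refl = refl
  free′ {t = suc (suc t)} eq with _ , refl , eq′ ← addPair-just M {t = t} eq =
    addPair-lift M (free eq′)
  unique′ : ∀ {s t t′} → lookup (addPair M) t ≡ just s → lookup (addPair M) t′ ≡ just s → t ≡ t′
  unique′ {t = suc zero}    {suc zero}     _    _   = refl
  unique′ {t = suc zero}    {suc (suc t′)} refl eq with _ , () , _ ← addPair-just M {t = t′} eq
  unique′ {t = suc (suc t)} {suc zero}     eq refl with _ , () , _ ← addPair-just M {t = t} eq
  unique′ {t = suc (suc t)} {suc (suc t′)} eq₁ eq₂
    with _ , refl , eq₁′ ← addPair-just M {t = t} eq₁
    with _ , refl , eq₂′ ← addPair-just M {t = t′} eq₂ =
      cong (λ t → suc (suc t)) (unique eq₁′ eq₂′)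
  covered′ : ∀ {s} → lookup (addPair M) s ≡ nothing → ∃[ t ] lookup (addPair M) t ≡ just s
  covered′ {zero}        _  = suc zero , refl
  covered′ {suc (suc s)} eq with lookup M s in eq′ | trans (sym (addPair-lift M {t = s} refl)) eq
  ... | nothing | _ with t , eq″ ← covered eq′ = suc (suc t) , addPair-lift M eq″

-- The leading `0ℝ` is the term of request 0, whose distance is charged to its later partner,
-- request 1. The other terms agree after the shift by two, once both lists are written as
-- tabulations.
cost-addPair : ∀ {n} x y (r : Vec Point n) M →
               cost (x ∷ y ∷ r) (addPair M) ≡ 0ℝ + (dist x y + cost r M)
cost-addPair {n} x y r M = cong (λ ds → 0ℝ + (dist x y + ∑ ds))
  (trans (Listₚ.map-tabulate (λ t → suc (suc t)) _)
    (trans (Listₚ.tabulate-cong shifted) (sym (Listₚ.map-tabulate (λ t → t) _))))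
  where
  shifted : ∀ t →
    maybe′ (λ s → dist (lookup (x ∷ y ∷ r) s) (lookup r t)) 0ℝ (lookup (addPair M) (suc (suc t)))
    ≡ maybe′ (λ s → dist (lookup r s) (lookup r t)) 0ℝ (lookup M t)
  shifted t rewrite addPair-lift M {t = t} refl with lookup M t
  ... | just _  = refl
  ... | nothing = refl

cost-addPair-same : ∀ {n} x (r : Vec Point n) M i →
                    seq (cost (x ∷ x ∷ r) (addPair M)) i ≡ seq (cost r M) i
cost-addPair-same x r M i = trans (cong (λ d → seq d i) (cost-addPair x x r M))
  (trans (ℚₚ.+-identityˡ _)
  (trans (cong (λ d → ℚ.∣ d ∣ ℚ.+ seq (cost r M) i) (ℚₚ.+-inverseʳ (seq (loc x) i)))
         (ℚₚ.+-identityˡ _)))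

-- This matching will be optimal for both hard instances, `paired` and `tight`.
consecutive : ∀ k → Matching (k ℕ.* 2 ℕ.+ 4)
consecutive zero    = addPair (addPair [])
consecutive (suc k) = addPair (consecutive k)

consecutive-perfect : ∀ k → IsPerfect (consecutive k)
consecutive-perfect zero    = addPair-perfect (addPair-perfect record
  { earlier = λ { {t = ()} } ; free = λ { {t = ()} } ; unique = λ { {t = ()} } ; covered = λ { {()} } })
consecutive-perfect (suc k) = addPair-perfect (consecutive-perfect k)

-- Requests at 0, δ and 1

-- Symbolic locations, so that distinctness is settled by pattern matching instead of by a
-- comparison of reals.
data Site : Set where
  left near right : Site

module Sites (δ : ℚ) (0<δ : 0ℚ ℚ.< δ) (δ≤½ : δ ℚ.≤ ½) where

  δ≤1 : δ ℚ.≤ 1ℚ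
  δ≤1 = ℚₚ.≤-trans δ≤½ (p≤p+nonneg {½} {½} (ℚₚ.nonNegative⁻¹ ½))

  site : Site → Point
  site left  = point 0ℝ ≤-refl (fromℚ-mono-≤ (ℚₚ.nonNegative⁻¹ 1ℚ))
  site near  = point (fromℚ δ) (fromℚ-mono-≤ (ℚₚ.<⇒≤ 0<δ)) (fromℚ-mono-≤ δ≤1)
  site right = point 1ℝ (fromℚ-mono-≤ (ℚₚ.nonNegative⁻¹ 1ℚ)) ≤-refl

  coordinate : Site → ℚ
  coordinate a = seq (loc (site a)) 0

  site-constant : ∀ a i → seq (loc (site a)) i ≡ coordinate a
  site-constant left  _ = refl
  site-constant near  _ = refl
  site-constant right _ = refl

  δ≤∣near∣ : δ ℚ.≤ ℚ.∣ δ ℚ.- 0ℚ ∣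
  δ≤∣near∣ = subst (λ p → δ ℚ.≤ ℚ.∣ p ∣) (sym (ℚₚ.+-identityʳ δ)) (p≤∣p∣ δ)

  δ≤∣1-near∣ : δ ℚ.≤ ℚ.∣ 1ℚ ℚ.- δ ∣
  δ≤∣1-near∣ = ℚₚ.≤-trans δ≤½ (ℚₚ.≤-trans (ℚₚ.+-monoʳ-≤ 1ℚ (ℚₚ.neg-antimono-≤ δ≤½)) (p≤∣p∣ (1ℚ ℚ.- δ)))

  -- The bound `δ ≤ ½` enters for `near` and `right`, where it gives `δ ≤ 1 - δ`.
  separated : ∀ {a b} → a ≢ b → fromℚ δ ≤ dist (site a) (site b)
  separated {left}  {left}  a≢b = contradiction refl a≢b
  separated {near}  {near}  a≢b = contradiction refl a≢b
  separated {right} {right} a≢b = contradiction refl a≢b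
  separated {near}  {left}  _   = pointwise⇒≤ λ _ → δ≤∣near∣
  separated {left}  {near}  _   = pointwise⇒≤ λ _ → subst (δ ℚ.≤_) (∣p-q∣≡∣q-p∣ δ 0ℚ) δ≤∣near∣
  separated {right} {near}  _   = pointwise⇒≤ λ _ → δ≤∣1-near∣
  separated {near}  {right} _   = pointwise⇒≤ λ _ → subst (δ ℚ.≤_) (∣p-q∣≡∣q-p∣ 1ℚ δ) δ≤∣1-near∣
  separated {left}  {right} _   = pointwise⇒≤ λ _ → δ≤1
  separated {right} {left}  _   = pointwise⇒≤ λ _ → δ≤1

  sites : ∀ {n} → Vec Site n → Vec Point n
  sites = Vec.map site

  dist≤sitesCost : ∀ {n} (σ : Vec Site n) M {s t} → lookup M t ≡ just s →
                   dist (site (lookup σ s)) (site (lookup σ t)) ≤ cost (sites σ) M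
  dist≤sitesCost σ M {s} {t} eq = subst₂ (λ x y → dist x y ≤ cost (sites σ) M)
    (Vecₚ.lookup-map s site σ) (Vecₚ.lookup-map t site σ) (dist≤cost (sites σ) M eq)

  -- All sites are constant sequences, hence so is the cost. Comparing it with a rational thus
  -- becomes a decidable question about rationals, which supplies the hypothesis of `markov`.
  cost-constant : ∀ {n} (σ : Vec Site n) M i →
                  seq (cost (sites σ) M) i ≡ seq (cost (sites σ) M) 0
  cost-constant {n} σ M i = ∑-constant (List.allFin n)
    where
    term : Fin n → ℝ
    term t = maybe′ (λ s → dist (lookup (sites σ) s) (lookup (sites σ) t)) 0ℝ (lookup M t)
    location : ∀ t → seq (loc (lookup (sites σ) t)) i ≡ seq (loc (lookup (sites σ) t)) 0
    location t rewrite Vecₚ.lookup-map t site σ = site-constant (lookup σ t) i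
    term-constant : ∀ t → seq (term t) i ≡ seq (term t) 0
    term-constant t with lookup M t
    ... | nothing = refl
    ... | just s  = cong₂ (λ p q → ℚ.∣ p ℚ.- q ∣) (location s) (location t)
    ∑-constant : ∀ ts → seq (∑ (List.map term ts)) i ≡ seq (∑ (List.map term ts)) 0
    ∑-constant []       = refl
    ∑-constant (t ∷ ts) = cong₂ ℚ._+_ (term-constant t) (∑-constant ts)

  cost-≥? : ∀ {n} (σ : Vec Site n) κ M → Dec (fromℚ κ ≤ cost (sites σ) M)
  cost-≥? σ κ M with κ ℚₚ.≤? seq (cost (sites σ) M) 0
  ... | yes κ≤ = yes (pointwise⇒≤ λ i → subst (κ ℚ.≤_) (sym (cost-constant σ M i)) κ≤)
  ... | no κ≰  = no λ κ≤ → κ≰ (fromℚ-cancel-≤ (≤-trans κ≤ (≗⇒≤ (cost-constant σ M))))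

  -- `paired` and `free` are the same multiset: the first order makes `consecutive` free of cost,
  -- the second is the order used against the algorithm. `tight` continues the prefix of `free` that
  -- ends with the first request at `δ`.
  paired free tight : ∀ k → Vec Site (k ℕ.* 2 ℕ.+ 4)
  paired = pad right (left ∷ left ∷ near ∷ near ∷ [])
  free   = pad right (left ∷ near ∷ left ∷ near ∷ [])
  tight  = pad right (left ∷ near ∷ right ∷ right ∷ [])

  first second : ∀ k → Fin (k ℕ.* 2 ℕ.+ 4)
  first  k = late k zero
  second k = late k (suc zero)

  free-tight-agree : ∀ k s → s Fin.≤ second k → lookup (sites (free k)) s ≡ lookup (sites (tight k)) s
  free-tight-agree k s s≤ = trans (Vecₚ.lookup-map s site (free k))
    (trans (cong site (agree (position k s) s≤)) (sym (Vecₚ.lookup-map s site (tight k))))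
    where
    agree : ∀ {s} → Position k s → s Fin.≤ second k → lookup (free k) s ≡ lookup (tight k) s
    agree (padding _ ≡x) _ = trans (≡x right _) (sym (≡x right _))
    agree (tail t) t≤ = trans (lookup-late right _ k t)
      (trans (among t (late-cancel-≤ k t≤)) (sym (lookup-late right _ k t)))
      where
      among : ∀ (t : Fin 4) → toℕ t ℕ.≤ 1 → lookup (left ∷ near ∷ left ∷ near ∷ []) t
                                     ≡ lookup (left ∷ near ∷ right ∷ right ∷ []) t
      among zero             _           = refl
      among (suc zero)       _           = refl
      among (suc (suc _))    (ℕ.s≤s ())

  -- When this request at 0 arrives, all earlier ones are at 1.
  free-first-cost : ∀ k {M s} → IsPerfect M → lookup M (first k) ≡ just s →
                    fromℚ δ ≤ cost (sites (free k)) M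
  free-first-cost k {M} {s} perfect eq = ≤-trans (separated distinct) (dist≤sitesCost (free k) M eq)
    where
    distinct : lookup (free k) s ≢ lookup (free k) (first k)
    distinct rewrite lookup-late right (left ∷ near ∷ left ∷ near ∷ []) k zero
      with position k s | IsPerfect.earlier perfect eq
    ... | padding _ ≡x | _ rewrite ≡x right (left ∷ near ∷ left ∷ near ∷ []) = λ ()
    ... | tail t | t<  with () ← late-cancel-< k {s = t} {t = zero} t<

  -- The earlier requests are at 1 or at 0, so none coincides with this request at `δ`.
  free-second-cost : ∀ k {M s} → IsPerfect M → lookup M (second k) ≡ just s →
                     fromℚ δ ≤ cost (sites (free k)) M
  free-second-cost k {M} {s} perfect eq = ≤-trans (separated distinct) (dist≤sitesCost (free k) M eq)
    where
    distinct : lookup (free k) s ≢ lookup (free k) (second k)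
    distinct rewrite lookup-late right (left ∷ near ∷ left ∷ near ∷ []) k (suc zero)
      with position k s | IsPerfect.earlier perfect eq
    ... | padding _ ≡x | _ rewrite ≡x right (left ∷ near ∷ left ∷ near ∷ []) = λ ()
    ... | tail t | t<  with t | late-cancel-< k {s = t} {t = suc zero} t<
    ...   | zero  | _ rewrite lookup-late right (left ∷ near ∷ left ∷ near ∷ []) k zero = λ ()
    ...   | suc _ | ℕ.s≤s ()

  tight-first-partner : ∀ k {t} → first k Fin.< t → t ≢ second k → lookup (tight k) t ≡ right
  tight-first-partner k {t} first<t t≢second with position k t
  ... | padding t< _                = contradiction (t< zero) (ℕₚ.<⇒≯ first<t)
  ... | tail zero                   = contradiction first<t (ℕₚ.<-irrefl refl)
  ... | tail (suc zero)             = contradiction refl t≢second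
  ... | tail (suc (suc zero))       = lookup-late right _ k (suc (suc zero))
  ... | tail (suc (suc (suc zero))) = lookup-late right _ k (suc (suc (suc zero)))

  -- The request at 0 needs a later partner. The request at `δ` is not it, having matched nothing on
  -- arrival, and the only others still to come are at 1.
  tight-unmatched-cost : ∀ k {M} → IsPerfect M →
    lookup M (first k) ≡ nothing → lookup M (second k) ≡ nothing →
    1ℝ ≤ cost (sites (tight k)) M
  tight-unmatched-cost k {M} perfect eq₁ eq₂ with t , eq ← IsPerfect.covered perfect eq₁ =
    ≤-trans (subst₂ (λ a b → 1ℝ ≤ dist (site a) (site b))
              (sym (lookup-late right _ k zero))
              (sym (tight-first-partner k (IsPerfect.earlier perfect eq) t≢second))
              (≗⇒≤ λ _ → refl))
      (dist≤sitesCost (tight k) M eq)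
    where
    t≢second : _ ≢ second k
    t≢second refl with () ← trans (sym eq₂) eq

  -- Only one request is at 0, so its partner, whether earlier or later, is at another site. This is
  -- the lower bound in `tight-opt`.
  tight-cost-≥δ : ∀ k {M} → IsPerfect M → fromℚ δ ≤ cost (sites (tight k)) M
  tight-cost-≥δ k {M} perfect with lookup M (first k) in eq
  ... | just s  = ≤-trans (separated distinct) (dist≤sitesCost (tight k) M eq)
    where
    distinct : lookup (tight k) s ≢ lookup (tight k) (first k)
    distinct rewrite lookup-late right (left ∷ near ∷ right ∷ right ∷ []) k zero
      with position k s | IsPerfect.earlier perfect eq
    ... | padding _ ≡x | _ rewrite ≡x right (left ∷ near ∷ right ∷ right ∷ []) = λ ()
    ... | tail t | t<  with () ← late-cancel-< k {s = t} {t = zero} t<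
  ... | nothing with t , eq′ ← IsPerfect.covered perfect eq =
    ≤-trans (separated (distinct (t Finₚ.≟ second k))) (dist≤sitesCost (tight k) M eq′)
    where
    distinct : Dec (t ≡ second k) → lookup (tight k) (first k) ≢ lookup (tight k) t
    distinct (yes refl) rewrite lookup-late right (left ∷ near ∷ right ∷ right ∷ []) k zero
      | lookup-late right (left ∷ near ∷ right ∷ right ∷ []) k (suc zero) = λ ()
    distinct (no t≢) rewrite lookup-late right (left ∷ near ∷ right ∷ right ∷ []) k zero
      | tight-first-partner k (IsPerfect.earlier perfect eq′) t≢ = λ ()

  paired-consecutive : ∀ k i → seq (cost (sites (paired k)) (consecutive k)) i ≡ 0ℚ
  paired-consecutive zero    i = trans (cost-addPair-same (site left) (site near ∷ site near ∷ []) (addPair []) i)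
                                       (cost-addPair-same (site near) [] [] i)
  paired-consecutive (suc k) i =
    trans (cost-addPair-same (site right) (sites (paired k)) (consecutive k) i) (paired-consecutive k i)

  tight-consecutive : ∀ k i → seq (cost (sites (tight k)) (consecutive k)) i ≡ δ
  tight-consecutive zero    i = trans (ℚₚ.+-identityˡ _) (trans (ℚₚ.+-identityʳ _) ∣0-δ∣≡δ)
    where
    ∣0-δ∣≡δ : ℚ.∣ 0ℚ ℚ.- δ ∣ ≡ δ
    ∣0-δ∣≡δ = trans (∣p-q∣≡∣q-p∣ 0ℚ δ)
      (trans (cong ℚ.∣_∣ (ℚₚ.+-identityʳ δ)) (ℚₚ.0≤p⇒∣p∣≡p (ℚₚ.<⇒≤ 0<δ)))
  tight-consecutive (suc k) i =
    trans (cost-addPair-same (site right) (sites (tight k)) (consecutive k) i) (tight-consecutive k i)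

  paired-opt : ∀ k → IsOpt (sites (paired k)) 0ℝ
  paired-opt k = record
    { attained = consecutive k , consecutive-perfect k , ≗⇒≈ (paired-consecutive k)
    ; minimal  = λ {M} _ → cost-nonneg (sites (paired k)) M }

  tight-opt : ∀ k → IsOpt (sites (tight k)) (fromℚ δ)
  tight-opt k = record
    { attained = consecutive k , consecutive-perfect k , ≗⇒≈ (tight-consecutive k)
    ; minimal  = tight-cost-≥δ k }

  free∈paired : ∀ k → sites (free k) ∈ permutations (sites (paired k))
  free∈paired = pad-∈-permutations site right
    (left ∷ near ∷ left ∷ near ∷ []) (left ∷ left ∷ near ∷ near ∷ [])
    -- The tail `0, δ, 0, δ` arises by inserting the first request at 0 into the unpermuted rest
    -- `0, δ, δ` at the third place.
    (there (there (here refl)))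

-- The lower bound for a fixed algorithm

even≥4 : ∀ {n} → 4 ℕ.≤ n → 2 ∣ n → ∃[ k ] n ≡ k ℕ.* 2 ℕ.+ 4
even≥4 (ℕ.s≤s (ℕ.s≤s ())) (divides 1 refl)
even≥4 _ (divides (suc (suc k)) refl) = k , ℕₚ.+-comm 4 (k ℕ.* 2)

module LowerBound (k : ℕ) (Alg : OnlineAlgorithm (k ℕ.* 2 ℕ.+ 4)) (c : ℝ) where
  open OnlineAlgorithm Alg
  open Expectation Alg

  n : ℕ
  n = k ℕ.* 2 ℕ.+ 4

  ρ : ℚ
  ρ = ℚ._/_ (+ 1) (n !) {{n !≢0}}

  0<ρ : 0ℚ ℚ.< ρ
  0<ρ = ℚₚ.positive⁻¹ _ {{ℚₚ.normalize-pos 1 (n !) {{n !≢0}}}}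

  -- The threshold is the cost forced on `tight`: weight `ρ` of one arrival order, probability at
  -- least ½ of waiting twice, and cost at least 1 in that event.
  small : ∃[ δ ] (0ℚ ℚ.< δ × δ ℚ.≤ ½ × c * fromℚ δ < fromℚ (ρ ℚ.* ½))
  small = scaleBelow c (*ℚ-pos 0<ρ 0<½) 0<½

  δ : ℚ
  δ = proj₁ small

  0<δ : 0ℚ ℚ.< δ
  0<δ = proj₁ (proj₂ small)

  open Sites δ 0<δ (proj₁ (proj₂ (proj₂ small)))

  decision : Vec Site n → Fin n → Ω → Maybe (Fin n)
  decision σ t ω = decide ω t (truncate (Finₚ.toℕ<n t) (sites σ))

  isNothing : Maybe (Fin n) → Bool
  isNothing m = does (Maybeₚ.≡-dec Finₚ._≟_ m nothing)

  -- The event is read off `free`; for the first two requests after the padding,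
  -- `free-tight-decision` carries it over to `tight`.
  waits : Fin n → Ω → Bool
  waits t ω = isNothing (decision (free k) t ω)

  bothWait : Ω → Bool
  bothWait ω = waits (first k) ω ∧ waits (second k) ω

  bothWait-measurable : Measurable bothWait
  bothWait-measurable = measurable-∩ (decide-measurable (first k) _ nothing) (decide-measurable (second k) _ nothing)

  run-decision : ∀ σ ω t → lookup (run ω (sites σ)) t ≡ decision σ t ω
  run-decision σ ω t = Vecₚ.lookup∘tabulate _ t

  free-tight-decision : ∀ t → t Fin.≤ second k → ∀ ω → decision (free k) t ω ≡ decision (tight k) t ω
  free-tight-decision t t≤ ω = cong (decide ω t) (truncate-cong t (Finₚ.toℕ<n t)
    λ s s≤t → free-tight-agree k s (ℕₚ.≤-trans s≤t t≤))

  first≤second : ∀ k → first k Fin.≤ second k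
  first≤second zero    = ℕ.z≤n
  first≤second (suc k) = ℕ.s≤s (ℕ.s≤s (first≤second k))

  someMatched : ∀ m₁ m₂ → not (isNothing m₁ ∧ isNothing m₂) ≡ true →
                (∃[ s ] m₁ ≡ just s) ⊎ (∃[ s ] m₂ ≡ just s)
  someMatched (just s) _        _ = inj₁ (s , refl)
  someMatched nothing  (just s) _ = inj₂ (s , refl)

  noneMatched : ∀ m₁ m₂ → isNothing m₁ ∧ isNothing m₂ ≡ true → m₁ ≡ nothing × m₂ ≡ nothing
  noneMatched nothing nothing _ = refl , refl

  free-cost : ∀ ω → not (bothWait ω) ≡ true → fromℚ δ ≤ cost (sites (free k)) (run ω (sites (free k)))
  free-cost ω ¬w = Sum.[
      (λ (_ , eq) → free-first-cost k perfect (trans (run-decision (free k) ω (first k)) eq))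
    , (λ (_ , eq) → free-second-cost k perfect (trans (run-decision (free k) ω (second k)) eq)) ]′
    (someMatched (decision (free k) (first k) ω) (decision (free k) (second k) ω) ¬w)
    where
    perfect : IsPerfect (run ω (sites (free k)))
    perfect = run-perfect ω (sites (free k))

  tight-cost : ∀ ω → bothWait ω ≡ true → 1ℝ ≤ cost (sites (tight k)) (run ω (sites (tight k)))
  tight-cost ω w = tight-unmatched-cost k (run-perfect ω (sites (tight k)))
    (unmatched (first k) (first≤second k) (proj₁ none))
    (unmatched (second k) ℕₚ.≤-refl (proj₂ none))
    where
    none : decision (free k) (first k) ω ≡ nothing × decision (free k) (second k) ω ≡ nothing
    none = noneMatched (decision (free k) (first k) ω) (decision (free k) (second k) ω) w
    unmatched : ∀ t → t Fin.≤ second k → decision (free k) t ω ≡ nothing →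
                lookup (run ω (sites (tight k))) t ≡ nothing
    unmatched t t≤ eq = trans (run-decision (tight k) ω t) (trans (sym (free-tight-decision t t≤ ω)) eq)

  someMatch : Ω → Bool
  someMatch ω = not (bothWait ω)

  paired-cost-≥ : fromℚ ρ * (fromℚ δ * ℙ someMatch) ≤ randomOrderCost Alg (sites (paired k))
  paired-cost-≥ = randomOrderCost-≥ (sites (paired k)) (free∈paired k)
    (markov (sites (free k)) (ℚₚ.<⇒≤ 0<δ) (cost-≥? (free k) δ) (measurable-∁ bothWait-measurable) free-cost)

  tight-cost-≥ : fromℚ ρ * (1ℝ * ℙ bothWait) ≤ randomOrderCost Alg (sites (tight k))
  tight-cost-≥ = randomOrderCost-≥ (sites (tight k)) (∈-permutations-refl _)
    (markov (sites (tight k)) (ℚₚ.nonNegative⁻¹ 1ℚ) (cost-≥? (tight k) 1ℚ) bothWait-measurable tight-cost)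

  ℙbothWait≥½ : ℙ someMatch ≤ fromℚ ½ → fromℚ ½ ≤ ℙ bothWait
  ℙbothWait≥½ ℙsome≤½ = begin
    fromℚ ½                                ∼⟨ ≗⇒≤ (λ _ → refl) ⟩
    1ℝ + fromℚ (ℚ.- ½)                     ∼⟨ +-mono-≤ total ≤-refl ⟩
    (ℙ bothWait + fromℚ ½) + fromℚ (ℚ.- ½)        ∼⟨ ≗⇒≤ (λ i → solve 1 (λ p → p :+ con ½ :+ con (ℚ.- ½) := p) refl (seq (ℙ bothWait) i)) ⟩
    ℙ bothWait                                    ∎
    where
    total : 1ℝ ≤ ℙ bothWait + fromℚ ½
    total = begin
      1ℝ                 ∼⟨ ≈⇒≥ ℙ-total ⟩
      -- Since `true ∧ b` reduces to `b`, the two parts of the sure event are `bothWait` and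
      -- `someMatch` by definition.
      ℙ (λ _ → true)     ∼⟨ ℙ-split bothWait (measurable-∁ measurable-∅) bothWait-measurable ⟩
      ℙ bothWait + ℙ someMatch         ∼⟨ +-mono-≤ ≤-refl ℙsome≤½ ⟩
      ℙ bothWait + fromℚ ½      ∎

  BadInstance : Set
  BadInstance = Σ[ I ∈ Vec Point n ] Σ[ opt ∈ ℝ ] (IsOpt I opt × c * opt < randomOrderCost Alg I)

  -- The optimum is 0, so any positive expected cost exceeds its multiple by `c`, however small the
  -- probability is.
  bad-paired : 0ℝ < ℙ someMatch → BadInstance
  bad-paired 0<ℙsome = sites (paired k) , 0ℝ , paired-opt k ,
    ≤-<-trans {c * 0ℝ} {0ℝ} (≗⇒≤ λ i → ℚₚ.*-zeroʳ (seq c i))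
      (<-≤-trans (scale-pos 0<ρ (scale-pos 0<δ 0<ℙsome)) paired-cost-≥)

  bad-tight : ℙ someMatch ≤ fromℚ ½ → BadInstance
  bad-tight ℙsome≤½ = sites (tight k) , fromℚ δ , tight-opt k ,
    <-≤-trans (proj₂ (proj₂ (proj₂ small))) (begin
      fromℚ (ρ ℚ.* ½)                         ∼⟨ ≗⇒≤ (λ _ → refl) ⟩
      fromℚ ρ * fromℚ ½                       ∼⟨ *-monoʳ-≤ (fromℚ-mono-≤ (ℚₚ.<⇒≤ 0<ρ)) (ℙbothWait≥½ ℙsome≤½) ⟩
      fromℚ ρ * ℙ bothWait                           ∼⟨ ≗⇒≤ (λ i → cong (ρ ℚ.*_) (sym (ℚₚ.*-identityˡ (seq (ℙ bothWait) i)))) ⟩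
      fromℚ ρ * (1ℝ * ℙ bothWait)                    ∼⟨ tight-cost-≥ ⟩
      randomOrderCost Alg (sites (tight k))   ∎)

  -- Whether `ℙ someMatch` vanishes cannot be decided, but `bad-tight` tolerates values up to ½, so
  -- the overlapping alternatives of `positive-or-≤` suffice.
  badInstance : BadInstance
  badInstance = Sum.[ bad-paired , bad-tight ]′ (positive-or-≤ (ℙ someMatch) 0<½)

theorem2 : (n : ℕ) → 4 ℕ.≤ n → 2 ∣ n →
    (Alg : OnlineAlgorithm n) (c : ℝ) → 0ℝ < c →
    Σ[ I ∈ Vec Point n ] Σ[ opt ∈ ℝ ] (IsOpt I opt × c * opt < randomOrderCost Alg I)
theorem2 n 4≤n 2∣n with k , refl ← even≥4 4≤n 2∣n = λ Alg c _ → LowerBound.badInstance k Alg c
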